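{- Let $G$ be a graph. Then $\chi_{lt}(G)=3$ if and only if $G$ is (isomorphic to) one of the following graphs: $P_3$; $P_6$; $mC_6$ for some integer $m\ge 1$; or $mC_6+P_6$ for some integer $m\ge 0$.
   Context: All graphs are finite, simple and loopless, of order $p=|V|\ge 3$ and size $q=|E|\ge 2$, with no isolated vertex and no $K_2$ component (graphs may be disconnected). A local total antimagic labeling of $G=(V,E)$ is a bijection $f:V\cup E\to\{1,\dots,p+q\}$ such that, with weights $w_f(u)=\sum f(e)$ over all edges $e$ incident to $u$ for $u\in V$ (the label of $u$ itself is not included) and $w_f(uv)=f(u)+f(v)$ for $uv\in E$, one has: adjacent vertices have distinct weights, adjacent edges have distinct weights, and every vertex has a weight distinct from that of each of its incident edges. $\chi_{lt}(G)$ is the minimum, over all local total antimagic labelings $f$ of $G$, of the number of distinct values among all the vertex and edge weights. $G+H$ is the disjoint union of $G$ and $H$, $mG$ is the disjoint union of $m$ copies of $G$ (so $0C_6+P_6=P_6$), $P_n$ is the path on $n$ vertices and $C_n$ is the cycle on $n$ vertices. -}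

module Defs where

open import Data.Nat using (ℕ; zero; suc; _+_; _≤_; _≥_; _≤?_; _≟_)
open import Data.Nat.Properties using (1+n≢n; m≢1+m+n; +-comm)
open import Data.Fin using (Fin; zero; suc; toℕ; fromℕ; inject₁; splitAt; _↑ˡ_; _↑ʳ_)
import Data.Fin as Fin
open import Data.Fin.Properties
  using (suc-injective; inject₁-injective; toℕ-inject₁;
         ↑ˡ-injective; ↑ʳ-injective; splitAt-↑ˡ; splitAt-↑ʳ; join-splitAt)
open import Data.Nat.ListAction using (sum)
open import Data.List using (List; map; filter; length; deduplicate; allFin; _++_)
open import Data.Product using (Σ-syntax; ∃-syntax; _×_; _,_)
open import Data.Sum using (_⊎_; inj₁; inj₂; [_,_]′)
open import Data.Empty using (⊥-elim)
open import Function.Base using (_∘_)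
open import Function.Bundles using (_↔_; _⤖_; _⇔_; Inverse; Bijection)
open import Relation.Binary.PropositionalEquality
  using (_≡_; _≢_; refl; sym; trans; cong)
open import Relation.Nullary using (¬_; Dec)
open import Relation.Nullary.Decidable using (True; _⊎-dec_)

Joins : ∀ {p q} (src tgt : Fin q → Fin p) → Fin q → Fin p → Fin p → Set
Joins src tgt e u v = (src e ≡ u × tgt e ≡ v) ⊎ (src e ≡ v × tgt e ≡ u)

-- A finite simple loopless graph with vertex set `Fin order` and edge set
-- `Fin size`.  Each edge is stored with its two ends in some order; this order
-- carries no meaning, as `simple` and all that follows only depend on the unordered
-- pair of ends.
record Graph : Set where
  field
    order : ℕ
    size  : ℕ

  V : Set
  V = Fin order

  E : Set
  E = Fin size

  field
    src tgt  : E → V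
    loopless : ∀ e → src e ≢ tgt e
    simple   : ∀ {e e′ u v} → Joins src tgt e u v → Joins src tgt e′ u v → e ≡ e′

  Adjacent : V → V → Set
  Adjacent u v = ∃[ e ] Joins src tgt e u v

  Incident : V → E → Set
  Incident u e = src e ≡ u ⊎ tgt e ≡ u

  incident? : ∀ u e → Dec (Incident u e)
  incident? u e = (src e Fin.≟ u) ⊎-dec (tgt e Fin.≟ u)

  AdjacentEdges : E → E → Set
  AdjacentEdges e e′ = e ≢ e′ × ∃[ u ] (Incident u e × Incident u e′)

open Graph

-- A K₂ component is a pair of adjacent vertices, each of which is the only
-- neighbour of the other.
record Admissible (G : Graph) : Set where
  field
    order≥3         : order G ≥ 3
    size≥2          : size G ≥ 2
    no-isolated     : ∀ u → ∃[ v ] Adjacent G u v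
    no-K₂-component : ∀ u v → Adjacent G u v →
                      ¬ ((∀ w → Adjacent G u w → w ≡ v) ×
                         (∀ w → Adjacent G v w → w ≡ u))

infix 4 _≅_
_≅_ : Graph → Graph → Set
G ≅ H = Σ[ φ ∈ V G ↔ V H ]
          (∀ u v → Adjacent G u v ⇔ Adjacent H (Inverse.to φ u) (Inverse.to φ v))

-- `Fin (p + q)` stands for {1, …, p + q}; `label` shifts it by one.
Labeling : Graph → Set
Labeling G = (V G ⊎ E G) ⤖ Fin (order G + size G)

label : (G : Graph) → Labeling G → V G ⊎ E G → ℕ
label G f x = suc (toℕ (Bijection.to f x))

vertexWeight : (G : Graph) → Labeling G → V G → ℕ
vertexWeight G f u =
  sum (map (label G f ∘ inj₂) (filter (incident? G u) (allFin (size G))))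

edgeWeight : (G : Graph) → Labeling G → E G → ℕ
edgeWeight G f e = label G f (inj₁ (src G e)) + label G f (inj₁ (tgt G e))

record LocalTotalAntimagic (G : Graph) (f : Labeling G) : Set where
  field
    vertices≢ : ∀ u v → Adjacent G u v → vertexWeight G f u ≢ vertexWeight G f v
    edges≢    : ∀ e e′ → AdjacentEdges G e e′ → edgeWeight G f e ≢ edgeWeight G f e′
    incident≢ : ∀ u e → Incident G u e → vertexWeight G f u ≢ edgeWeight G f e

weights : (G : Graph) → Labeling G → List ℕ
weights G f = map (vertexWeight G f) (allFin (order G))
           ++ map (edgeWeight G f) (allFin (size G))

numWeights : (G : Graph) → Labeling G → ℕ
numWeights G f = length (deduplicate _≟_ (weights G f))

IsMinimum : (ℕ → Set) → ℕ → Set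
IsMinimum S k = S k × (∀ j → S j → k ≤ j)

-- The minimum is a relation, not a function, so that the existence of a local
-- total antimagic labeling is part of what `χₗₜ G ≔ k` asserts.
infix 4 χₗₜ_≔_
χₗₜ_≔_ : Graph → ℕ → Set
χₗₜ G ≔ k =
  IsMinimum (λ j → Σ[ f ∈ Labeling G ] (LocalTotalAntimagic G f × numWeights G f ≡ j)) k

∅ : Graph
∅ = record
  { order = 0 ; size = 0 ; src = λ () ; tgt = λ ()
  ; loopless = λ () ; simple = λ { {()} } }

private
  inject₁≢suc : ∀ {n} (i : Fin n) → inject₁ i ≢ suc i
  inject₁≢suc i eq = 1+n≢n (sym (trans (sym (toℕ-inject₁ i)) (cong toℕ eq)))

  no-swap : ∀ {n} (i j : Fin n) → inject₁ i ≡ suc j → suc i ≢ inject₁ j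
  no-swap i j p q = m≢1+m+n (toℕ i) {1} (trans (trans
    (trans (sym (toℕ-inject₁ i)) (cong toℕ p))
    (cong suc (trans (sym (toℕ-inject₁ j)) (sym (cong toℕ q)))))
    (cong suc (+-comm 1 (toℕ i))))

P : ℕ → Graph
P zero    = ∅
P (suc n) = record
  { order = suc n ; size = n ; src = inject₁ ; tgt = suc
  ; loopless = inject₁≢suc ; simple = simp }
  where
  simp : ∀ {e e′ u v} → Joins inject₁ suc e u v → Joins inject₁ suc e′ u v → e ≡ e′
  simp (inj₁ (_ , refl)) (inj₁ (_ , q)) = sym (suc-injective q)
  simp (inj₂ (_ , refl)) (inj₂ (_ , q)) = sym (suc-injective q)
  simp {e} {e′} (inj₁ (refl , refl)) (inj₂ (p , q)) = ⊥-elim (no-swap e e′ (sym q) (sym p))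
  simp {e} {e′} (inj₂ (refl , refl)) (inj₁ (p , q)) = ⊥-elim (no-swap e e′ (sym q) (sym p))

-- C n is the path on 0, …, n − 1 (edge `suc i` joins i and i + 1) together with
-- the closing edge `zero`, which joins n − 1 and 0.
C : (n : ℕ) → {True (3 ≤? n)} → Graph
C (suc (suc (suc k))) = record
  { order = 3 + k ; size = 3 + k ; src = s ; tgt = t
  ; loopless = loop ; simple = simp }
  where
  s t : Fin (3 + k) → Fin (3 + k)
  s zero    = fromℕ (2 + k)
  s (suc i) = inject₁ i
  t zero    = zero
  t (suc i) = suc i
  loop : ∀ e → s e ≢ t e
  loop zero    ()
  loop (suc i) = inject₁≢suc i
  no-swap′ : ∀ e e′ → s e ≡ t e′ → t e ≢ s e′
  no-swap′ zero    zero    ()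
  no-swap′ zero    (suc zero)    () q
  no-swap′ zero    (suc (suc j)) p ()
  no-swap′ (suc zero)    zero p ()
  no-swap′ (suc (suc i)) zero () q
  no-swap′ (suc i) (suc j) p q = no-swap i j p q
  t-injective : ∀ e e′ → t e ≡ t e′ → e ≡ e′
  t-injective zero    zero    _ = refl
  t-injective (suc i) (suc j) p = p
  simp : ∀ {e e′ u v} → Joins s t e u v → Joins s t e′ u v → e ≡ e′
  simp {e} {e′} (inj₁ (_ , refl)) (inj₁ (_ , q)) = sym (t-injective e′ e q)
  simp {e} {e′} (inj₂ (_ , refl)) (inj₂ (_ , q)) = sym (t-injective e′ e q)
  simp {e} {e′} (inj₁ (refl , refl)) (inj₂ (p , q)) = ⊥-elim (no-swap′ e e′ (sym q) (sym p))
  simp {e} {e′} (inj₂ (refl , refl)) (inj₁ (p , q)) = ⊥-elim (no-swap′ e e′ (sym q) (sym p))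

infixr 5 _⊕_
_⊕_ : Graph → Graph → Graph
G ⊕ H = record
  { order = p ; size = q ; src = s ; tgt = t ; loopless = loop ; simple = simp }
  where
  p q : ℕ
  p = order G + order H
  q = size G + size H
  side : (E G → V G) → (E H → V H) → E G ⊎ E H → Fin p
  side g h = [ (λ e → g e ↑ˡ order H) , (λ e → order G ↑ʳ h e) ]′
  s t : Fin q → Fin p
  s e = side (src G) (src H) (splitAt (size G) e)
  t e = side (tgt G) (tgt H) (splitAt (size G) e)
  disj : ∀ {u : V G} {v : V H} → u ↑ˡ order H ≢ order G ↑ʳ v
  disj {u} {v} eq with trans (sym (splitAt-↑ˡ (order G) u (order H)))
                        (trans (cong (splitAt (order G)) eq)
                               (splitAt-↑ʳ (order G) (order H) v))
  ... | ()
  injˡ : ∀ {u v : V G} → u ↑ˡ order H ≡ v ↑ˡ order H → u ≡ v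
  injˡ = ↑ˡ-injective (order H) _ _
  injʳ : ∀ {u v : V H} → order G ↑ʳ u ≡ order G ↑ʳ v → u ≡ v
  injʳ = ↑ʳ-injective (order G) _ _
  loop : ∀ e → s e ≢ t e
  loop e with splitAt (size G) e
  ... | inj₁ a = loopless G a ∘ injˡ
  ... | inj₂ b = loopless H b ∘ injʳ
  SameEnds : E G ⊎ E H → E G ⊎ E H → Set
  SameEnds x y = (side (src G) (src H) x ≡ side (src G) (src H) y ×
                  side (tgt G) (tgt H) x ≡ side (tgt G) (tgt H) y)
               ⊎ (side (src G) (src H) x ≡ side (tgt G) (tgt H) y ×
                  side (tgt G) (tgt H) x ≡ side (src G) (src H) y)
  same : ∀ x y → SameEnds x y → x ≡ y
  same (inj₁ a) (inj₁ b) (inj₁ (m , n)) =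
    cong inj₁ (simple G (inj₁ (injˡ m , injˡ n)) (inj₁ (refl , refl)))
  same (inj₁ a) (inj₁ b) (inj₂ (m , n)) =
    cong inj₁ (simple G (inj₁ (injˡ m , injˡ n)) (inj₂ (refl , refl)))
  same (inj₂ a) (inj₂ b) (inj₁ (m , n)) =
    cong inj₂ (simple H (inj₁ (injʳ m , injʳ n)) (inj₁ (refl , refl)))
  same (inj₂ a) (inj₂ b) (inj₂ (m , n)) =
    cong inj₂ (simple H (inj₁ (injʳ m , injʳ n)) (inj₂ (refl , refl)))
  same (inj₁ a) (inj₂ b) (inj₁ (m , _)) = ⊥-elim (disj m)
  same (inj₁ a) (inj₂ b) (inj₂ (m , _)) = ⊥-elim (disj m)
  same (inj₂ a) (inj₁ b) (inj₁ (m , _)) = ⊥-elim (disj (sym m))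
  same (inj₂ a) (inj₁ b) (inj₂ (m , _)) = ⊥-elim (disj (sym m))
  split-injective : ∀ e e′ → splitAt (size G) e ≡ splitAt (size G) e′ → e ≡ e′
  split-injective e e′ eq =
    trans (sym (join-splitAt (size G) (size H) e))
      (trans (cong (Fin.join (size G) (size H)) eq)
             (join-splitAt (size G) (size H) e′))
  ends : ∀ {e e′ u v} → Joins s t e u v → Joins s t e′ u v →
         SameEnds (splitAt (size G) e) (splitAt (size G) e′)
  ends (inj₁ (a , b)) (inj₁ (c , d)) = inj₁ (trans a (sym c) , trans b (sym d))
  ends (inj₂ (a , b)) (inj₂ (c , d)) = inj₁ (trans a (sym c) , trans b (sym d))
  ends (inj₁ (a , b)) (inj₂ (c , d)) = inj₂ (trans a (sym d) , trans b (sym c))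
  ends (inj₂ (a , b)) (inj₁ (c , d)) = inj₂ (trans a (sym d) , trans b (sym c))
  simp : ∀ {e e′ u v} → Joins s t e u v → Joins s t e′ u v → e ≡ e′
  simp {e} {e′} x y = split-injective e e′ (same _ _ (ends {e} {e′} x y))

infixr 6 _·_
_·_ : ℕ → Graph → Graph
zero  · G = ∅
suc m · G = G ⊕ m · G

{-# OPTIONS --safe #-}
module Submission where

-- With only three weights a vertex and its incident edges already use up all of them, so
-- every component is a path or a cycle, along which the weights of vertices and edges
-- alternate with period 3.  A weight is the sum of the two labels next to it, so the labels
-- satisfy xᵢ₊₂ = wᵢ₊₁ - xᵢ and hence xᵢ₊₁₂ = xᵢ.  Injectivity of the labelling leaves only the
-- cycle C₆, and since a path starts with x₀ = 0 and ends on a 0, only the paths P₃ and P₆.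
-- The weight of a leaf is the label of its edge, so there are at most three leaves and at
-- most one path.  P₃ cannot occur beside a C₆: in P₃ one weight is the sum of the other two,
-- while C₆ forces the strict triangle inequality on every ordering of the three weights.
-- Conversely, m hexagons are labelled by translates of {0, 1, 2} paired so that the sums are
-- constant; starting the labels at 0 and deleting the edge labelled 0 turns a hexagon into P₆.

open import Defs
open import Data.Nat using (ℕ; zero; suc; _+_; _*_; _∸_; pred; _≤_; _<_; _≥_; z≤n; s≤s; >-nonZero)
open import Data.Nat.Properties
open import Data.Nat.ListAction using (sum)
open import Data.Nat.Tactic.RingSolver using (solve-∀)
open import Data.Fin using (Fin; zero; suc; toℕ; fromℕ; fromℕ<; inject₁; splitAt; join; _↑ˡ_; _↑ʳ_; punchOut)
import Data.Fin as Fin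
open import Data.Fin.Patterns
import Data.Fin.Properties as Finₚ
open import Data.Fin.Properties using (any?; all?; toℕ<n; toℕ-fromℕ<; toℕ-injective; injective⇒≤; splitAt-↑ˡ; splitAt-↑ʳ)
open import Data.Fin.Induction using (<-weakInduction)
open import Data.Fin.Permutation using (↔⇒≡)
open import Data.List using (List; []; _∷_; map; filter; length; lookup; deduplicate; allFin)
open import Data.List.Membership.Propositional using (_∈_)
open import Data.List.Membership.Propositional.Properties
  using (∈-filter⁺; ∈-filter⁻; ∈-allFin; ∈-lookup; ∈-map⁺; ∈-map⁻; ∈-++⁺ˡ; ∈-++⁺ʳ; ∈-++⁻; ∈-deduplicate⁺; ∈-deduplicate⁻)
open import Data.List.Relation.Unary.Any using (here; there; index)
open import Data.List.Relation.Unary.Any.Properties using (lookup-index)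
open import Data.List.Relation.Unary.All using (All; []; _∷_)
import Data.List.Relation.Unary.All as All
open import Data.List.Relation.Unary.AllPairs using ([]; _∷_)
open import Data.List.Relation.Unary.Unique.Propositional using (Unique)
open import Data.List.Relation.Unary.Unique.Propositional.Properties using (filter⁺; allFin⁺)
open import Data.List.Relation.Unary.Unique.DecPropositional.Properties _≟_ using (deduplicate-!)
open import Data.Product using (Σ-syntax; ∃-syntax; _×_; _,_; proj₁; proj₂)
open import Data.Sum using (_⊎_; inj₁; inj₂; [_,_]′; swap)
import Data.Sum as Sum
open import Data.Sum.Properties using (≡-dec; inj₁-injective; inj₂-injective)
open import Data.Empty using (⊥; ⊥-elim)
open import Data.Unit using (⊤; tt)
open import Function.Base using (_∘_; id; case_of_)
open import Function.Bundles using (_⇔_; Equivalence; Inverse; Bijection; mk⇔; mk⤖; mk↔ₛ′)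
open import Relation.Binary.PropositionalEquality
  using (_≡_; _≢_; refl; sym; trans; cong; cong₂; subst; subst₂; module ≡-Reasoning)
open import Relation.Nullary using (¬_; Dec; yes; no; contradiction)
open import Relation.Nullary.Decidable using (_×-dec_; _⊎-dec_; _→-dec_; ¬?; from-yes; decidable-stable)

open Graph

-- Counting in lists and finite sets

lookup-injective : ∀ {A : Set} {xs : List A} → Unique xs →
                   ∀ {i j} → lookup xs i ≡ lookup xs j → i ≡ j
lookup-injective (_ ∷ _)      {zero}  {zero}  _  = refl
lookup-injective {xs = _ ∷ xs} (x≢ ∷ _) {zero}  {suc j} eq = contradiction eq (All.lookup x≢ (∈-lookup j))
lookup-injective {xs = _ ∷ xs} (x≢ ∷ _) {suc i} {zero}  eq = contradiction (sym eq) (All.lookup x≢ (∈-lookup i))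
lookup-injective (_ ∷ u)      {suc i} {suc j} eq = cong suc (lookup-injective u eq)

-- Sending a position in `xs` to the place where its entry is found in `ys` is injective, as `xs`
-- has no repetition.
Unique-⊆⇒length≤ : ∀ {A : Set} {xs ys : List A} → Unique xs →
                   (∀ {x} → x ∈ xs → x ∈ ys) → length xs ≤ length ys
Unique-⊆⇒length≤ {xs = xs} {ys} u sub = injective⇒≤ {f = position} position-injective
  where
  position : Fin (length xs) → Fin (length ys)
  position i = index (sub (∈-lookup i))
  position-injective : ∀ {i j} → position i ≡ position j → i ≡ j
  position-injective {i} {j} eq = lookup-injective u
    (trans (lookup-index (sub (∈-lookup i)))
      (trans (cong (lookup ys) eq) (sym (lookup-index (sub (∈-lookup j))))))

-- A missed value could be punched out of the codomain, leaving an injection of `Fin (suc n)` into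
-- `Fin n`.
injective⇒surjective : ∀ {n} (f : Fin n → Fin n) → (∀ {i j} → f i ≡ f j → i ≡ j) →
                       ∀ y → ∃[ x ] f x ≡ y
injective⇒surjective {suc n} f inj y with any? (λ x → f x Fin.≟ y)
... | yes hit = hit
... | no miss = contradiction (injective⇒≤ {f = λ x → punchOut (y≢ x)} squeeze) 1+n≰n
  where
  y≢ : ∀ x → y ≢ f x
  y≢ x eq = miss (x , sym eq)
  squeeze : ∀ {i j} → punchOut (y≢ i) ≡ punchOut (y≢ j) → i ≡ j
  squeeze {i} {j} eq = inj (Finₚ.punchOut-injective (y≢ i) (y≢ j) eq)

-- Edges, stars and weights

Link : (G : Graph) → E G → V G → V G → Set
Link G = Joins (src G) (tgt G)

module _ (G : Graph) where

  link-of : ∀ e → Link G e (src G e) (tgt G e)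
  link-of _ = inj₁ (refl , refl)

  link-sym : ∀ {e u v} → Link G e u v → Link G e v u
  link-sym = swap

  link⇒incidentˡ : ∀ {e u v} → Link G e u v → Incident G u e
  link⇒incidentˡ = Sum.map proj₁ proj₂

  link⇒incidentʳ : ∀ {e u v} → Link G e u v → Incident G v e
  link⇒incidentʳ l = link⇒incidentˡ (link-sym l)

  incident⇒link : ∀ {e u} → Incident G u e → ∃[ v ] Link G e u v
  incident⇒link {e} (inj₁ refl) = tgt G e , inj₁ (refl , refl)
  incident⇒link {e} (inj₂ refl) = src G e , inj₂ (refl , refl)

  link-functional : ∀ {e u v w} → Link G e u v → Link G e u w → v ≡ w
  link-functional (inj₁ (_ , refl)) (inj₁ (_ , refl)) = refl
  link-functional (inj₂ (refl , _)) (inj₂ (refl , _)) = refl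
  link-functional {e} (inj₁ (p , _)) (inj₂ (_ , q)) = contradiction (trans p (sym q)) (loopless G e)
  link-functional {e} (inj₂ (_ , p)) (inj₁ (q , _)) = contradiction (trans q (sym p)) (loopless G e)

  link-ends : ∀ {e u v w} → Link G e u v → Incident G w e → w ≡ u ⊎ w ≡ v
  link-ends (inj₁ (refl , refl)) (inj₁ refl) = inj₁ refl
  link-ends (inj₁ (refl , refl)) (inj₂ refl) = inj₂ refl
  link-ends (inj₂ (refl , refl)) (inj₁ refl) = inj₂ refl
  link-ends (inj₂ (refl , refl)) (inj₂ refl) = inj₁ refl

  adjacent-sym : ∀ {u v} → Adjacent G u v → Adjacent G v u
  adjacent-sym (e , l) = e , link-sym l

  edgesAt : V G → List (E G)
  edgesAt u = filter (incident? G u) (allFin (size G))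

  edgesAt-unique : ∀ u → Unique (edgesAt u)
  edgesAt-unique u = filter⁺ (incident? G u) (allFin⁺ (size G))

  ∈-edgesAt⁺ : ∀ {u e} → Incident G u e → e ∈ edgesAt u
  ∈-edgesAt⁺ {u} {e} i = ∈-filter⁺ (incident? G u) (∈-allFin e) i

  ∈-edgesAt⁻ : ∀ {u e} → e ∈ edgesAt u → Incident G u e
  ∈-edgesAt⁻ {u} m = proj₂ (∈-filter⁻ (incident? G u) {xs = allFin (size G)} m)

module _ {A : Set} (g : A → ℕ) where

  sum-singleton : ∀ {a} {xs : List A} → Unique xs → a ∈ xs → (∀ {x} → x ∈ xs → x ≡ a) →
                  sum (map g xs) ≡ g a
  sum-singleton {xs = x ∷ []} _ m all rewrite all (here refl) = +-identityʳ _
  sum-singleton {xs = x ∷ y ∷ _} ((x≢y ∷ _) ∷ _) m all =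
    contradiction (trans (all (here refl)) (sym (all (there (here refl))))) x≢y

  sum-pair : ∀ {a b} {xs : List A} → a ≢ b → Unique xs → a ∈ xs → b ∈ xs →
             (∀ {x} → x ∈ xs → x ≡ a ⊎ x ≡ b) → sum (map g xs) ≡ g a + g b
  sum-pair {xs = x ∷ []} a≢b _ (here refl) (here refl) all = contradiction refl a≢b
  -- A third entry would put a repetition-free list of length at least three inside a list of two
  -- entries.
  sum-pair {a} {b} {x ∷ y ∷ z ∷ zs} a≢b u ma mb all =
    contradiction (Unique-⊆⇒length≤ {ys = a ∷ b ∷ []} u (λ m → [ here , there ∘ here ]′ (all m))) λ { (s≤s (s≤s ())) }
  sum-pair {xs = x ∷ y ∷ []} a≢b ((x≢y ∷ _) ∷ _) ma mb all
    with all (here refl) | all (there (here refl))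
  ... | inj₁ refl | inj₁ refl = contradiction refl x≢y
  ... | inj₂ refl | inj₂ refl = contradiction refl x≢y
  ... | inj₁ refl | inj₂ refl = cong (g x +_) (+-identityʳ (g y))
  ... | inj₂ refl | inj₁ refl = trans (cong (g x +_) (+-identityʳ (g y))) (+-comm (g x) (g y))

module _ (G : Graph) (f : Labeling G) where

  vertexWeight-leaf : ∀ {u e} → Incident G u e → (∀ d → Incident G u d → d ≡ e) →
                      vertexWeight G f u ≡ label G f (inj₂ e)
  vertexWeight-leaf {u} i only = sum-singleton _ (edgesAt-unique G u) (∈-edgesAt⁺ G i)
    (λ m → only _ (∈-edgesAt⁻ G m))

  vertexWeight-turn : ∀ {u e e′} → e ≢ e′ → Incident G u e → Incident G u e′ →
                      (∀ d → Incident G u d → d ≡ e ⊎ d ≡ e′) →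
                      vertexWeight G f u ≡ label G f (inj₂ e) + label G f (inj₂ e′)
  vertexWeight-turn {u} e≢e′ i i′ only = sum-pair _ e≢e′ (edgesAt-unique G u)
    (∈-edgesAt⁺ G i) (∈-edgesAt⁺ G i′) (λ m → only _ (∈-edgesAt⁻ G m))

  vertexWeight∈weights : ∀ u → vertexWeight G f u ∈ weights G f
  vertexWeight∈weights u = ∈-++⁺ˡ (∈-map⁺ (vertexWeight G f) (∈-allFin u))

  edgeWeight∈weights : ∀ e → edgeWeight G f e ∈ weights G f
  edgeWeight∈weights e = ∈-++⁺ʳ (map (vertexWeight G f) (allFin (order G))) (∈-map⁺ (edgeWeight G f) (∈-allFin e))

  ∈-weights⁻ : ∀ {x} → x ∈ weights G f → (∃[ u ] x ≡ vertexWeight G f u) ⊎ (∃[ e ] x ≡ edgeWeight G f e)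
  ∈-weights⁻ m with ∈-++⁻ (map (vertexWeight G f) (allFin (order G))) m
  ... | inj₁ m′ = let u , _ , eq = ∈-map⁻ (vertexWeight G f) m′ in inj₁ (u , eq)
  ... | inj₂ m′ = let e , _ , eq = ∈-map⁻ (edgeWeight G f) m′ in inj₂ (e , eq)

  unique-weights⇒length≤numWeights : ∀ {xs} → Unique xs → (∀ {x} → x ∈ xs → x ∈ weights G f) →
                                     length xs ≤ numWeights G f
  unique-weights⇒length≤numWeights u sub =
    Unique-⊆⇒length≤ u (λ m → ∈-deduplicate⁺ _≟_ (sub m))

  edgeWeight-link : ∀ {e u v} → Link G e u v →
                    edgeWeight G f e ≡ label G f (inj₁ u) + label G f (inj₁ v)
  edgeWeight-link (inj₁ (refl , refl)) = refl
  edgeWeight-link (inj₂ (refl , refl)) = +-comm (label G f (inj₁ (src G _))) _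

-- Unions of components

-- An embedding of H onto a union of components of G.
infix 4 _↪_
record _↪_ (H G : Graph) : Set where
  field
    vmap           : V H → V G
    vmap-injective : ∀ {x y} → vmap x ≡ vmap y → x ≡ y
    forth          : ∀ e → Adjacent G (vmap (src H e)) (vmap (tgt H e))
    back           : ∀ x {w} → Adjacent G (vmap x) w → ∃[ y ] vmap y ≡ w × Adjacent H x y

  -- The edge map is read off from `forth`: simplicity of `G` leaves only one edge over a given pair
  -- of ends.
  emap : E H → E G
  emap e = proj₁ (forth e)

  emap-link : ∀ {e x y} → Link H e x y → Link G (emap e) (vmap x) (vmap y)
  emap-link {e} (inj₁ (refl , refl)) = proj₂ (forth e)
  emap-link {e} (inj₂ (refl , refl)) = link-sym G (proj₂ (forth e))

  adjacent-forth : ∀ {x y} → Adjacent H x y → Adjacent G (vmap x) (vmap y)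
  adjacent-forth (e , l) = emap e , emap-link l

  Image : V G → Set
  Image v = ∃[ x ] vmap x ≡ v

  image? : ∀ v → Dec (Image v)
  image? v = any? (λ x → vmap x Fin.≟ v)

  -- By `back`, a neighbour of an image vertex is an image vertex, so the complement of an image is
  -- a union of components too.
  outside-closed : ∀ {u v} → ¬ Image u → Adjacent G u v → ¬ Image v
  outside-closed u∉ adj (x , refl) =
    let y , eq , _ = back x (adjacent-sym G adj) in u∉ (y , eq)

open _↪_

data Split {m n : ℕ} : Fin (m + n) → Set where
  left  : (i : Fin m) → Split (i ↑ˡ n)
  right : (j : Fin n) → Split (m ↑ʳ j)

split : ∀ m {n} (i : Fin (m + n)) → Split i
split m {n} i with splitAt m i | Finₚ.join-splitAt m n i
... | inj₁ a | refl = left a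
... | inj₂ b | refl = right b

module _ {m n : ℕ} {A : Set} (g : Fin m → A) (h : Fin n → A) where

  copair : Fin (m + n) → A
  copair = [ g , h ]′ ∘ splitAt m

  copair-↑ˡ : ∀ i → copair (i ↑ˡ n) ≡ g i
  copair-↑ˡ i rewrite splitAt-↑ˡ m i n = refl

  copair-↑ʳ : ∀ j → copair (m ↑ʳ j) ≡ h j
  copair-↑ʳ j rewrite splitAt-↑ʳ m n j = refl

↑ˡ≢↑ʳ : ∀ {m n} {i : Fin m} {j : Fin n} → i ↑ˡ n ≢ m ↑ʳ j
↑ˡ≢↑ʳ {m} {n} {i} {j} eq with trans (sym (splitAt-↑ˡ m i n)) (trans (cong (splitAt m) eq) (splitAt-↑ʳ m n j))
... | ()

module _ (H K : Graph) where

  src-↑ˡ : ∀ e → src (H ⊕ K) (e ↑ˡ size K) ≡ src H e ↑ˡ order K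
  src-↑ˡ e rewrite splitAt-↑ˡ (size H) e (size K) = refl

  tgt-↑ˡ : ∀ e → tgt (H ⊕ K) (e ↑ˡ size K) ≡ tgt H e ↑ˡ order K
  tgt-↑ˡ e rewrite splitAt-↑ˡ (size H) e (size K) = refl

  src-↑ʳ : ∀ e → src (H ⊕ K) (size H ↑ʳ e) ≡ order H ↑ʳ src K e
  src-↑ʳ e rewrite splitAt-↑ʳ (size H) (size K) e = refl

  tgt-↑ʳ : ∀ e → tgt (H ⊕ K) (size H ↑ʳ e) ≡ order H ↑ʳ tgt K e
  tgt-↑ʳ e rewrite splitAt-↑ʳ (size H) (size K) e = refl

  link-↑ˡ⁻ : ∀ {e u w} → Link (H ⊕ K) (e ↑ˡ size K) u w →
             ∃[ x ] ∃[ y ] x ↑ˡ order K ≡ u × y ↑ˡ order K ≡ w × Link H e x y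
  link-↑ˡ⁻ {e} (inj₁ (refl , refl)) = _ , _ , sym (src-↑ˡ e) , sym (tgt-↑ˡ e) , inj₁ (refl , refl)
  link-↑ˡ⁻ {e} (inj₂ (refl , refl)) = _ , _ , sym (tgt-↑ˡ e) , sym (src-↑ˡ e) , inj₂ (refl , refl)

  link-↑ʳ⁻ : ∀ {e u w} → Link (H ⊕ K) (size H ↑ʳ e) u w →
             ∃[ x ] ∃[ y ] order H ↑ʳ x ≡ u × order H ↑ʳ y ≡ w × Link K e x y
  link-↑ʳ⁻ {e} (inj₁ (refl , refl)) = _ , _ , sym (src-↑ʳ e) , sym (tgt-↑ʳ e) , inj₁ (refl , refl)
  link-↑ʳ⁻ {e} (inj₂ (refl , refl)) = _ , _ , sym (tgt-↑ʳ e) , sym (src-↑ʳ e) , inj₂ (refl , refl)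

  inl↪ : H ↪ H ⊕ K
  vmap inl↪ x = x ↑ˡ order K
  vmap-injective inl↪ = Finₚ.↑ˡ-injective (order K) _ _
  forth inl↪ e = e ↑ˡ size K , inj₁ (src-↑ˡ e , tgt-↑ˡ e)
  back inl↪ x (d , l) with split (size H) d
  ... | left e with link-↑ˡ⁻ l
  ... | x′ , y , eq , refl , l′ with Finₚ.↑ˡ-injective (order K) _ _ eq
  ... | refl = y , refl , e , l′
  back inl↪ x (d , l) | right e with link-↑ʳ⁻ l
  ... | _ , _ , eq , _ = contradiction (sym eq) ↑ˡ≢↑ʳ

  inr↪ : K ↪ H ⊕ K
  vmap inr↪ x = order H ↑ʳ x
  vmap-injective inr↪ = Finₚ.↑ʳ-injective (order H) _ _
  forth inr↪ e = size H ↑ʳ e , inj₁ (src-↑ʳ e , tgt-↑ʳ e)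
  back inr↪ x (d , l) with split (size H) d
  ... | right e with link-↑ʳ⁻ l
  ... | x′ , y , eq , refl , l′ with Finₚ.↑ʳ-injective (order H) _ _ eq
  ... | refl = y , refl , e , l′
  back inr↪ x (d , l) | left e with link-↑ˡ⁻ l
  ... | _ , _ , eq , _ = contradiction eq ↑ˡ≢↑ʳ

module _ {H K G : Graph} (φ : H ↪ G) (ψ : K ↪ G) (disjoint : ∀ x y → vmap φ x ≢ vmap ψ y) where

  -- Each image is a union of components, so `back` answers within the summand of the given vertex;
  -- disjointness of the images gives injectivity across the summands.
  glue : H ⊕ K ↪ G
  vmap glue = copair (vmap φ) (vmap ψ)
  vmap-injective glue {x} {y} eq with split (order H) x | split (order H) y
  ... | left i  | left j  rewrite copair-↑ˡ (vmap φ) (vmap ψ) i | copair-↑ˡ (vmap φ) (vmap ψ) j =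
    cong (_↑ˡ order K) (vmap-injective φ eq)
  ... | left i  | right j rewrite copair-↑ˡ (vmap φ) (vmap ψ) i | copair-↑ʳ (vmap φ) (vmap ψ) j =
    contradiction eq (disjoint i j)
  ... | right i | left j  rewrite copair-↑ʳ (vmap φ) (vmap ψ) i | copair-↑ˡ (vmap φ) (vmap ψ) j =
    contradiction (sym eq) (disjoint j i)
  ... | right i | right j rewrite copair-↑ʳ (vmap φ) (vmap ψ) i | copair-↑ʳ (vmap φ) (vmap ψ) j =
    cong (order H ↑ʳ_) (vmap-injective ψ eq)
  forth glue d with split (size H) d
  ... | left e  rewrite src-↑ˡ H K e | tgt-↑ˡ H K e
                      | copair-↑ˡ (vmap φ) (vmap ψ) (src H e) | copair-↑ˡ (vmap φ) (vmap ψ) (tgt H e) = forth φ e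
  ... | right e rewrite src-↑ʳ H K e | tgt-↑ʳ H K e
                      | copair-↑ʳ (vmap φ) (vmap ψ) (src K e) | copair-↑ʳ (vmap φ) (vmap ψ) (tgt K e) = forth ψ e
  back glue x adj with split (order H) x
  ... | left i  rewrite copair-↑ˡ (vmap φ) (vmap ψ) i =
    let y , eq , adj′ = back φ i adj
    in y ↑ˡ order K , trans (copair-↑ˡ (vmap φ) (vmap ψ) y) eq , adjacent-forth (inl↪ H K) adj′
  ... | right i rewrite copair-↑ʳ (vmap φ) (vmap ψ) i =
    let y , eq , adj′ = back ψ i adj
    in order H ↑ʳ y , trans (copair-↑ʳ (vmap φ) (vmap ψ) y) eq , adjacent-forth (inr↪ H K) adj′

  glue-left : ∀ {v} → Image φ v → Image glue v
  glue-left (x , eq) = x ↑ˡ order K , trans (copair-↑ˡ (vmap φ) (vmap ψ) x) eq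

  glue-right : ∀ {v} → Image ψ v → Image glue v
  glue-right (x , eq) = order H ↑ʳ x , trans (copair-↑ʳ (vmap φ) (vmap ψ) x) eq

∅↪ : ∀ {G} → ∅ ↪ G
vmap ∅↪ ()
vmap-injective ∅↪ {()}
forth ∅↪ ()
back ∅↪ ()

onto⇒≅ : ∀ {H G} (ψ : H ↪ G) → (∀ v → Image ψ v) → G ≅ H
onto⇒≅ {H} {G} ψ onto =
  mk↔ₛ′ to (vmap ψ) (λ x → vmap-injective ψ (onto-to (vmap ψ x))) onto-to ,
  λ u v → mk⇔ (there′ u v) (λ adj → subst₂ (Adjacent G) (onto-to u) (onto-to v) (adjacent-forth ψ adj))
  where
  to : V G → V H
  to v = proj₁ (onto v)
  onto-to : ∀ v → vmap ψ (to v) ≡ v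
  onto-to v = proj₂ (onto v)
  there′ : ∀ u v → Adjacent G u v → Adjacent H (to u) (to v)
  there′ u v adj with back ψ (to u) (subst (λ z → Adjacent G z v) (sym (onto-to u)) adj)
  ... | y , eq , adj′ = subst (Adjacent H (to u)) (vmap-injective ψ (trans eq (sym (onto-to v)))) adj′

≅⇒↪ : ∀ {G H} → G ≅ H → G ↪ H
vmap (≅⇒↪ (φ , _)) = Inverse.to φ
vmap-injective (≅⇒↪ (φ , _)) {x} {y} eq =
  trans (sym (Inverse.strictlyInverseʳ φ x)) (trans (cong (Inverse.from φ) eq) (Inverse.strictlyInverseʳ φ y))
forth (≅⇒↪ {G} (_ , adj)) e = Equivalence.to (adj _ _) (e , link-of G e)
back (≅⇒↪ {G} {H} (φ , adj)) x {w} a = Inverse.from φ w , Inverse.strictlyInverseˡ φ w ,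
  Equivalence.from (adj x _) (subst (Adjacent H (Inverse.to φ x)) (sym (Inverse.strictlyInverseˡ φ w)) a)

≅-image : ∀ {G H} (i : G ≅ H) w → Image (≅⇒↪ {G} {H} i) w
≅-image (φ , _) w = Inverse.from φ w , Inverse.strictlyInverseˡ φ w

≅-sym : ∀ {G H} → G ≅ H → H ≅ G
≅-sym {G} {H} i = onto⇒≅ (≅⇒↪ {G} {H} i) (≅-image {G} {H} i)

-- Connectedness, and covering by disjoint hexagons

module _ {G : Graph} (Q : V G → Set) (closed : ∀ {u v} → Q u → Adjacent G u v → Q v) where

  -- Connectedness in the form needed later: a predicate closed under adjacency spreads along the
  -- edges from the first vertex.
  path-connected : ∀ {n} (ψ : P (suc n) ↪ G) → Q (vmap ψ zero) → ∀ i → Q (vmap ψ i)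
  path-connected ψ q = <-weakInduction (Q ∘ vmap ψ) q (λ i qᵢ → closed qᵢ (forth ψ i))

  hexagon-connected : (ψ : C 6 ↪ G) → Q (vmap ψ zero) → ∀ i → Q (vmap ψ i)
  -- The edges `suc i` already form a spanning path; the closing edge is `zero`.
  hexagon-connected ψ q = <-weakInduction (Q ∘ vmap ψ) q (λ i qᵢ → closed qᵢ (forth ψ (suc i)))

-- `Free` marks the vertices left to be covered: all of them when there is no leaf, otherwise those
-- off the path already found.
HexagonCover : (G : Graph) → (V G → Set) → Set
HexagonCover G Free =
  ∃[ m ] Σ[ φ ∈ m · C 6 ↪ G ] ((∀ x → Free (vmap φ x)) × (∀ v → Free v → Image φ v))

module _ {G : Graph} {Free : V G → Set} (free? : ∀ v → Dec (Free v))
         (closed : ∀ {u v} → Free u → Adjacent G u v → Free v)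
         (hexagon-at : ∀ v → Free v → Σ[ ψ ∈ C 6 ↪ G ] vmap ψ zero ≡ v) where

  private
    m≤order : ∀ m → m ≤ order (m · C 6)
    m≤order zero    = z≤n
    m≤order (suc m) = s≤s (≤-trans (m≤order m) (m≤n+m _ 5))

    -- `k` is fuel for adding hexagons. As `m` disjoint hexagons force `m ≤ order G`, it cannot run
    -- out while `m + k ≡ suc (order G)`.
    grow : ∀ k m → m + k ≡ suc (order G) → (φ : m · C 6 ↪ G) → (∀ x → Free (vmap φ x)) → HexagonCover G Free
    grow zero m eq φ _ = contradiction
      (≤-trans (m≤order m) (injective⇒≤ (vmap-injective φ)))
      (<⇒≱ (≤-reflexive (trans (sym eq) (+-identityʳ m))))
    grow (suc k) m eq φ free with any? (λ v → free? v ×-dec ¬? (image? φ v))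
    ... | no none = m , φ , free ,
      λ v v-free → decidable-stable (image? φ v) (λ v∉ → none (v , v-free , v∉))
    ... | yes (v , v-free , v∉) with hexagon-at v v-free
    ... | ψ , refl = grow k (suc m) (trans (sym (+-suc m k)) eq)
      -- The new hexagon starts at a vertex outside the image of `φ`, so by connectedness all of it
      -- lies outside.
      (glue ψ φ (λ x y eq′ → hexagon-connected (¬_ ∘ Image φ) (outside-closed φ) ψ v∉ x (y , sym eq′)))
      free′
      where
      free′ : ∀ x → Free (copair (vmap ψ) (vmap φ) x)
      free′ x with split 6 x
      ... | left i  = subst Free (sym (copair-↑ˡ (vmap ψ) (vmap φ) i)) (hexagon-connected Free closed ψ v-free i)
      ... | right j = subst Free (sym (copair-↑ʳ (vmap ψ) (vmap φ) j)) (free j)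

  hexagon-cover : HexagonCover G Free
  hexagon-cover = grow (suc (order G)) 0 refl ∅↪ (λ ())

-- Graphs with a labelling of three weights

module Forward (G : Graph) (f : Labeling G) (lta : LocalTotalAntimagic G f)
               (three : numWeights G f ≡ 3) (admissible : Admissible G) where

  open LocalTotalAntimagic lta
  open Admissible admissible

  wv : V G → ℕ
  wv = vertexWeight G f

  we : E G → ℕ
  we = edgeWeight G f

  lv : V G → ℕ
  lv u = label G f (inj₁ u)

  le : E G → ℕ
  le e = label G f (inj₂ e)

  label-injective : ∀ {x y} → label G f x ≡ label G f y → x ≡ y
  label-injective eq = Bijection.injective f (toℕ-injective (suc-injective eq))

  le-injective : ∀ {d e} → le d ≡ le e → d ≡ e
  le-injective eq = inj₂-injective (label-injective eq)

  -- The assumption of three weights enters here: four distinct entries would make `numWeights` at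
  -- least four.
  ¬four-weights : ∀ {x y z t} → All (_∈ weights G f) (x ∷ y ∷ z ∷ t ∷ []) →
                  ¬ Unique (x ∷ y ∷ z ∷ t ∷ [])
  ¬four-weights mem u = contradiction
    (≤-trans (unique-weights⇒length≤numWeights G f u (All.lookup mem)) (≤-reflexive three)) 1+n≰n

  v∈ : ∀ u → wv u ∈ weights G f
  v∈ = vertexWeight∈weights G f

  e∈ : ∀ e → we e ∈ weights G f
  e∈ = edgeWeight∈weights G f

  -- Otherwise there would be four distinct weights. The equalities of weights along a walk all come
  -- from this.
  third : ∀ {x y z t} → All (_∈ weights G f) (x ∷ y ∷ z ∷ t ∷ []) →
          x ≢ y → x ≢ z → y ≢ z → t ≢ y → t ≢ z → t ≡ x
  third {x} {y} {z} {t} mem x≢y x≢z y≢z t≢y t≢z with t ≟ x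
  ... | yes eq  = eq
  ... | no t≢x = contradiction
    ((x≢y ∷ x≢z ∷ (t≢x ∘ sym) ∷ []) ∷ (y≢z ∷ (t≢y ∘ sym) ∷ []) ∷ ((t≢z ∘ sym) ∷ []) ∷ [] ∷ [])
    (¬four-weights mem)

  link⇒wv≢wv : ∀ {e u v} → Link G e u v → wv u ≢ wv v
  link⇒wv≢wv l = vertices≢ _ _ (_ , l)

  link⇒wv≢we : ∀ {e u v} → Link G e u v → wv u ≢ we e
  link⇒wv≢we l = incident≢ _ _ (link⇒incidentˡ G l)

  link⇒wv≢weʳ : ∀ {e u v} → Link G e u v → wv v ≢ we e
  link⇒wv≢weʳ l = link⇒wv≢we (link-sym G l)

  we-injective-at : ∀ {u d e} → Incident G u d → Incident G u e → we d ≡ we e → d ≡ e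
  we-injective-at {u} {d} {e} i j eq with d Fin.≟ e
  ... | yes d≡e = d≡e
  ... | no d≢e  = contradiction eq (edges≢ d e (d≢e , u , i , j))

  -- Three edges at `u` have distinct weights, all different from that of `u`, which makes four.
  degree≤2 : ∀ {u d e e′} → Incident G u d → Incident G u e → Incident G u e′ →
             d ≢ e → d ≢ e′ → e ≢ e′ → ⊥
  degree≤2 {u} {d} {e} {e′} i j k d≢e d≢e′ e≢e′ =
    ¬four-weights (v∈ u ∷ e∈ d ∷ e∈ e ∷ e∈ e′ ∷ [])
      ( (incident≢ u d i ∷ incident≢ u e j ∷ incident≢ u e′ k ∷ [])
      ∷ ((d≢e ∘ we-injective-at i j) ∷ (d≢e′ ∘ we-injective-at i k) ∷ [])
      ∷ ((e≢e′ ∘ we-injective-at j k) ∷ []) ∷ [] ∷ [])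

  -- Leaves, turns and the period of the weights

  IsLeaf : V G → E G → Set
  IsLeaf u e = Incident G u e × (∀ d → Incident G u d → d ≡ e)

  Leaf : V G → Set
  Leaf u = ∃[ e ] IsLeaf u e

  leaf? : ∀ u → Dec (Leaf u)
  leaf? u = any? λ e → incident? G u e ×-dec all? λ d → incident? G u d →-dec (d Fin.≟ e)

  -- A walk enters v from u through e and has to leave it through e′.
  record Turn (u : V G) (e : E G) (v : V G) (e′ : E G) : Set where
    field
      link     : Link G e u v
      incident : Incident G v e′
      distinct : e ≢ e′
      only     : ∀ d → Incident G v d → d ≡ e ⊎ d ≡ e′

  open Turn

  -- If a second edge leaves `v`, the degree bound leaves no room for a third.
  leaf-or-turn : ∀ {e u v} → Link G e u v → IsLeaf v e ⊎ (∃[ e′ ] Turn u e v e′)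
  leaf-or-turn {e} {u} {v} l with any? (λ d → incident? G v d ×-dec ¬? (d Fin.≟ e))
  ... | yes (e′ , i , e′≢e) = inj₂ (e′ , record
    { link = l ; incident = i ; distinct = e′≢e ∘ sym ; only = only′ })
    where
    only′ : ∀ d → Incident G v d → d ≡ e ⊎ d ≡ e′
    only′ d j with d Fin.≟ e | d Fin.≟ e′
    ... | yes eq | _      = inj₁ eq
    ... | no _   | yes eq = inj₂ eq
    ... | no d≢e | no d≢e′ = ⊥-elim (degree≤2 j (link⇒incidentʳ G l) i d≢e d≢e′ (e′≢e ∘ sym))
  ... | no none = inj₁ (link⇒incidentʳ G l , only′)
    where
    only′ : ∀ d → Incident G v d → d ≡ e
    only′ d j with d Fin.≟ e
    ... | yes eq = eq
    ... | no d≢e = contradiction (d , j , d≢e) none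

  turn-weight : ∀ {u e v e′} → Turn u e v e′ → wv v ≡ le e + le e′
  turn-weight t = vertexWeight-turn G f (distinct t) (link⇒incidentʳ G (link t)) (incident t) (only t)

  leaf-weight : ∀ {u e} → IsLeaf u e → wv u ≡ le e
  leaf-weight (i , only) = vertexWeight-leaf G f i only

  edge-weight : ∀ {e u v} → Link G e u v → we e ≡ lv u + lv v
  edge-weight = edgeWeight-link G f

  turn-we≢we : ∀ {u e v e′} → Turn u e v e′ → we e ≢ we e′
  turn-we≢we t = distinct t ∘ we-injective-at (link⇒incidentʳ G (link t)) (incident t)

  -- Along a walk the weights of vertices and edges, taken in order, have period 3.
  next-edge : ∀ {u e v e′} → Turn u e v e′ → we e′ ≡ wv u
  next-edge {u} {e} {v} {e′} t =
    third (v∈ u ∷ e∈ e ∷ v∈ v ∷ e∈ e′ ∷ [])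
      (link⇒wv≢we (link t)) (link⇒wv≢wv (link t)) (link⇒wv≢weʳ (link t) ∘ sym)
      (turn-we≢we t ∘ sym) (incident≢ v e′ (incident t) ∘ sym)

  next-vertex : ∀ {u e v e′ w} → Turn u e v e′ → Link G e′ v w → wv w ≡ we e
  next-vertex {u} {e} {v} {e′} {w} t l =
    third (e∈ e ∷ v∈ v ∷ e∈ e′ ∷ v∈ w ∷ [])
      (link⇒wv≢weʳ (link t) ∘ sym) (turn-we≢we t) (link⇒wv≢we l)
      (link⇒wv≢wv l ∘ sym) (link⇒wv≢weʳ l)

  turn-neighbours : ∀ {u e v e′ w x} → Turn u e v e′ → Link G e′ v w → Adjacent G v x → x ≡ u ⊎ x ≡ w
  turn-neighbours t l (d , m) with only t d (link⇒incidentˡ G m)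
  ... | inj₁ refl = inj₁ (link-functional G m (link-sym G (link t)))
  ... | inj₂ refl = inj₂ (link-functional G m l)

  leaf-neighbour : ∀ {u e v x} → IsLeaf u e → Link G e u v → Adjacent G u x → x ≡ v
  leaf-neighbour (_ , only) l (d , m) with only d (link⇒incidentˡ G m)
  ... | refl = link-functional G m l

  leaf≢turn : ∀ {x d u e v e′} → IsLeaf x d → Turn u e v e′ → x ≢ v
  leaf≢turn (_ , only) t refl =
    distinct t (trans (only _ (link⇒incidentʳ G (link t))) (sym (only _ (incident t))))

  one-apart : ∀ {e u v} → Link G e u v → u ≢ v
  one-apart l refl = link⇒wv≢wv l refl

  -- If `u` and `w` coincided, `next-vertex` would give `u` the weight of its own edge `e`.
  two-apart : ∀ {u e v e′ w} → Turn u e v e′ → Link G e′ v w → u ≢ w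
  two-apart t l refl = link⇒wv≢we (link t) (next-vertex t l)

  -- A triangle would make the label of v₀ equal to that of the edge opposite to it.
  three-apart : ∀ {v₀ e₀ v₁ e₁ v₂ e₂ v₃ e₃} →
                Turn v₀ e₀ v₁ e₁ → Turn v₁ e₁ v₂ e₂ → Turn v₂ e₂ v₃ e₃ → v₀ ≢ v₃
  three-apart {v₀} {e₀} {v₁} {e₁} {v₂} {e₂} {_} {e₃} t₁ t₂ t₃ refl
    -- Closing up after three steps puts `e₃` and `e₀` at the same vertex, with equal weights by the
    -- period; hence they are the same edge.
    with we-injective-at (incident t₃) (link⇒incidentˡ G (link t₁))
           (trans (next-edge t₃) (next-vertex t₁ (link t₂)))
  ... | refl = case label-injective (opposite (lv v₀) (lv v₁) (lv v₂) (le e₀) (le e₁) (le e₂)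
      (trans (sym (edge-weight (link t₁))) (trans (sym (next-vertex t₁ (link t₂))) (turn-weight t₂)))
      (trans (sym (edge-weight (link t₂))) (trans (sym (next-vertex t₂ (link t₃))) (turn-weight t₃)))
      (trans (sym (edge-weight (link t₃))) (trans (next-edge t₂) (turn-weight t₁)))) of λ ()
    where
    -- The first equation plus the third minus the second reads `2 * a ≡ 2 * q`.
    opposite : ∀ a b c p q r → a + b ≡ q + r → b + c ≡ r + p → c + a ≡ p + q → a ≡ q
    opposite a b c p q r h₁ h₂ h₃ = *-cancelˡ-≡ a q 2 (+-cancelʳ-≡ (b + c) (2 * a) (2 * q) (begin
      2 * a + (b + c)     ≡⟨ expandˡ a b c ⟩
      (a + b) + (c + a)   ≡⟨ cong₂ _+_ h₁ h₃ ⟩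
      (q + r) + (p + q)   ≡⟨ expandʳ p q r ⟩
      2 * q + (r + p)     ≡⟨ cong (2 * q +_) (sym h₂) ⟩
      2 * q + (b + c)     ∎))
      where
      open ≡-Reasoning
      expandˡ : ∀ a b c → 2 * a + (b + c) ≡ (a + b) + (c + a)
      expandˡ = solve-∀
      expandʳ : ∀ p q r → (q + r) + (p + q) ≡ 2 * q + (r + p)
      expandʳ = solve-∀

  -- A closed walk of six turns. Distinctness of the vertices is not stored: any two are at most
  -- three steps apart, where `one-apart`, `two-apart` and `three-apart` separate them.
  record Hexagon (v₀ : V G) : Set where
    field
      {v₁ v₂ v₃ v₄ v₅}    : V G
      {e₀ e₁ e₂ e₃ e₄ e₅} : E G
      t₀ : Turn v₅ e₅ v₀ e₀
      t₁ : Turn v₀ e₀ v₁ e₁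
      t₂ : Turn v₁ e₁ v₂ e₂
      t₃ : Turn v₂ e₂ v₃ e₃
      t₄ : Turn v₃ e₃ v₄ e₄
      t₅ : Turn v₄ e₄ v₅ e₅

  module _ {v₀ : V G} (h : Hexagon v₀) where
    open Hexagon h

    hexagon↪ : C 6 ↪ G
    vmap hexagon↪ = lookup (v₀ ∷ v₁ ∷ v₂ ∷ v₃ ∷ v₄ ∷ v₅ ∷ [])
    vmap-injective hexagon↪ = lookup-injective
      ( (one-apart (link t₁) ∷ two-apart t₁ (link t₂) ∷ three-apart t₁ t₂ t₃
          ∷ two-apart t₅ (link t₀) ∘ sym ∷ one-apart (link t₀) ∘ sym ∷ [])
      ∷ (one-apart (link t₂) ∷ two-apart t₂ (link t₃) ∷ three-apart t₂ t₃ t₄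
          ∷ two-apart t₀ (link t₁) ∘ sym ∷ [])
      ∷ (one-apart (link t₃) ∷ two-apart t₃ (link t₄) ∷ three-apart t₃ t₄ t₅ ∷ [])
      ∷ (one-apart (link t₄) ∷ two-apart t₄ (link t₅) ∷ [])
      ∷ (one-apart (link t₅) ∷ []) ∷ [] ∷ [])
    forth hexagon↪ 0F = e₅ , link t₀
    forth hexagon↪ 1F = e₀ , link t₁
    forth hexagon↪ 2F = e₁ , link t₂
    forth hexagon↪ 3F = e₂ , link t₃
    forth hexagon↪ 4F = e₃ , link t₄
    forth hexagon↪ 5F = e₄ , link t₅
    back hexagon↪ 0F adj with turn-neighbours t₀ (link t₁) adj
    ... | inj₁ refl = 5F , refl , 0F , inj₂ (refl , refl)
    ... | inj₂ refl = 1F , refl , 1F , inj₁ (refl , refl)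
    back hexagon↪ 1F adj with turn-neighbours t₁ (link t₂) adj
    ... | inj₁ refl = 0F , refl , 1F , inj₂ (refl , refl)
    ... | inj₂ refl = 2F , refl , 2F , inj₁ (refl , refl)
    back hexagon↪ 2F adj with turn-neighbours t₂ (link t₃) adj
    ... | inj₁ refl = 1F , refl , 2F , inj₂ (refl , refl)
    ... | inj₂ refl = 3F , refl , 3F , inj₁ (refl , refl)
    back hexagon↪ 3F adj with turn-neighbours t₃ (link t₄) adj
    ... | inj₁ refl = 2F , refl , 3F , inj₂ (refl , refl)
    ... | inj₂ refl = 4F , refl , 4F , inj₁ (refl , refl)
    back hexagon↪ 4F adj with turn-neighbours t₄ (link t₅) adj
    ... | inj₁ refl = 3F , refl , 4F , inj₂ (refl , refl)
    ... | inj₂ refl = 5F , refl , 5F , inj₁ (refl , refl)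
    back hexagon↪ 5F adj with turn-neighbours t₅ (link t₀) adj
    ... | inj₁ refl = 4F , refl , 5F , inj₂ (refl , refl)
    ... | inj₂ refl = 0F , refl , 0F , inj₁ (refl , refl)

  -- The outer edges together count the labels of both ends of `e`, and in addition the positive
  -- labels of `u` and `x`.
  triangle-inequality : ∀ {u d v e w d′ x} → Turn u d v e → Turn v e w d′ → Link G d′ w x →
                        we e < we d + we d′
  triangle-inequality {u} {d} {v} {e} {w} {d′} {x} t t′ l = begin-strict
    we e                            ≡⟨ edge-weight (link t′) ⟩
    lv v + lv w                     <⟨ +-mono-< (m<n+m (lv v) {lv u} (s≤s z≤n)) (m<m+n (lv w) {lv x} (s≤s z≤n)) ⟩
    (lv u + lv v) + (lv w + lv x)   ≡⟨ cong₂ _+_ (sym (edge-weight (link t))) (sym (edge-weight l)) ⟩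
    we d + we d′                    ∎
    where open ≤-Reasoning

  -- Both triples exhaust the three weights, so `u ≡ x` would make `v`, `w` a rearrangement of `y`,
  -- `z`; their sum would then both equal and exceed `x`.
  ¬degenerate : ∀ {u v w x y z} → All (_∈ weights G f) (u ∷ v ∷ w ∷ []) → All (_∈ weights G f) (x ∷ y ∷ z ∷ []) →
                v ≢ u → w ≢ u → v ≢ w → x ≢ y → x ≢ z → y ≢ z →
                u ≡ v + w → x < y + z → u ≢ x
  ¬degenerate {u} {v} {w} {x} {y} {z} (_ ∷ mv ∷ mw ∷ []) (mx ∷ my ∷ mz ∷ []) v≢x w≢x v≢w x≢y x≢z y≢z u≡ x< refl
    with v ≟ z
  ... | no v≢z = <-irrefl (trans u≡ (cong₂ _+_ v≡y w≡z)) x<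
    where
    v≡y : v ≡ y
    v≡y = third (my ∷ mx ∷ mz ∷ mv ∷ []) (x≢y ∘ sym) y≢z x≢z v≢x v≢z
    w≡z : w ≡ z
    w≡z = third (mz ∷ mx ∷ my ∷ mw ∷ []) (x≢z ∘ sym) (y≢z ∘ sym) x≢y w≢x (λ w≡y → v≢w (trans v≡y (sym w≡y)))
  ... | yes v≡z = <-irrefl (trans u≡ (trans (cong₂ _+_ v≡z w≡y) (+-comm z y))) x<
    where
    w≡y : w ≡ y
    w≡y = third (my ∷ mx ∷ mz ∷ mw ∷ []) (x≢y ∘ sym) y≢z x≢z w≢x (λ w≡z → v≢w (trans v≡z (sym w≡z)))

  -- In a P₃ the weight of the centre is the sum of the other two weights, whereas each
  -- of the three weights occurs on an edge of a hexagon with a strict triangle inequality.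
  ¬hexagon-and-P₃ : ∀ {v₀ x d y e z} → Hexagon v₀ → IsLeaf x d → Turn x d y e → Link G e y z → IsLeaf z e → ⊥
  ¬hexagon-and-P₃ {x = x} {d} {y} {e} {z} h x-leaf t l z-leaf =
    y≢e₁ (third (e∈ e₁ ∷ e∈ e₂ ∷ e∈ e₃ ∷ v∈ y ∷ [])
      (turn-we≢we t₂) e₁≢e₃ (turn-we≢we t₃)
      (centre≢ (e∈ e₂ ∷ e∈ e₁ ∷ e∈ e₃ ∷ []) (turn-we≢we t₂ ∘ sym) (turn-we≢we t₃) e₁≢e₃
        (triangle-inequality t₂ t₃ (link t₄)))
      (centre≢ (e∈ e₃ ∷ e∈ e₂ ∷ e∈ e₁ ∷ []) (turn-we≢we t₃ ∘ sym) (e₁≢e₃ ∘ sym) (turn-we≢we t₂ ∘ sym)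
        -- By the period, the weight of `e₄` is that of `e₁`. Below, `e₀` is likewise exchanged for
        -- `e₃`.
        (subst (λ k → we e₃ < we e₂ + k) (trans (next-edge t₄) (next-vertex t₂ (link t₃)))
          (triangle-inequality t₃ t₄ (link t₅)))))
    where
    open Hexagon h
    centre : wv y ≡ wv x + wv z
    centre = trans (turn-weight t) (sym (cong₂ _+_ (leaf-weight x-leaf) (leaf-weight z-leaf)))
    e₁≢e₃ : we e₁ ≢ we e₃
    e₁≢e₃ eq = link⇒wv≢weʳ (link t₂) (sym (trans eq (next-edge t₃)))
    x≢z : wv x ≢ wv z
    x≢z eq = link⇒wv≢we (link t) (trans eq (next-vertex t l))
    centre≢ : ∀ {p q r} → All (_∈ weights G f) (p ∷ q ∷ r ∷ []) → p ≢ q → p ≢ r → q ≢ r → p < q + r → wv y ≢ p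
    centre≢ mem p≢q p≢r q≢r = ¬degenerate (v∈ y ∷ v∈ x ∷ v∈ z ∷ []) mem
      (link⇒wv≢wv (link t)) (link⇒wv≢wv l ∘ sym) x≢z p≢q p≢r q≢r centre
    y≢e₁ : wv y ≢ we e₁
    y≢e₁ = centre≢ (e∈ e₁ ∷ e∈ e₃ ∷ e∈ e₂ ∷ []) e₁≢e₃ (turn-we≢we t₂) (turn-we≢we t₃ ∘ sym)
      (subst (λ k → we e₁ < k + we e₂) (sym (trans (next-edge t₃) (next-vertex t₁ (link t₂))))
        (triangle-inequality t₁ t₂ (link t₃)))

  -- Edges three steps apart have equal weights, hence equal sums of end labels. The alternating sum
  -- of three such equations leaves equal labels at `v₀` and `v₆`, and labels are injective.
  closes-up : ∀ {v₀ e₀ v₁ e₁ v₂ e₂ v₃ e₃ v₄ e₄ v₅ e₅ v₆} →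
              Turn v₀ e₀ v₁ e₁ → Turn v₁ e₁ v₂ e₂ → Turn v₂ e₂ v₃ e₃ → Turn v₃ e₃ v₄ e₄ → Turn v₄ e₄ v₅ e₅ →
              Link G e₅ v₅ v₆ → v₆ ≡ v₀
  closes-up {v₀} {v₁ = v₁} {v₂ = v₂} {v₃ = v₃} {v₄ = v₄} {v₅ = v₅} {v₆ = v₆} t₁ t₂ t₃ t₄ t₅ l₅ =
    inj₁-injective (label-injective (six (lv v₀) (lv v₁) (lv v₂) (lv v₃) (lv v₄) (lv v₅) (lv v₆)
      (opposite t₁ t₂ t₃ (link t₄)) (opposite t₂ t₃ t₄ (link t₅)) (opposite t₃ t₄ t₅ l₅)))
    where
    opposite : ∀ {a d b e c f g h k} → Turn a d b e → Turn b e c f → Turn c f g h → Link G h g k →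
               lv a + lv b ≡ lv g + lv k
    opposite s₁ s₂ s₃ l = trans (sym (edge-weight (link s₁)))
      (trans (sym (trans (next-edge s₃) (next-vertex s₁ (link s₂)))) (edge-weight l))
    six : ∀ a b c d p q r → a + b ≡ d + p → b + c ≡ p + q → c + d ≡ q + r → r ≡ a
    six a b c d p q r h₁ h₂ h₃ = sym (+-cancelˡ-≡ (b + c + d + p + q) a r (begin
      (b + c + d + p + q) + a           ≡⟨ expandˡ a b c d p q ⟩
      (a + b) + (p + q) + (c + d)       ≡⟨ cong₂ _+_ (cong₂ _+_ h₁ (sym h₂)) h₃ ⟩
      (d + p) + (b + c) + (q + r)       ≡⟨ expandʳ b c d p q r ⟩
      (b + c + d + p + q) + r           ∎))
      where
      open ≡-Reasoning
      expandˡ : ∀ a b c d p q → (b + c + d + p + q) + a ≡ (a + b) + (p + q) + (c + d)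
      expandˡ = solve-∀
      expandʳ : ∀ b c d p q r → (d + p) + (b + c) + (q + r) ≡ (b + c + d + p + q) + r
      expandʳ = solve-∀

  module Leafless (Free : V G → Set) (closed : ∀ {u v} → Free u → Adjacent G u v → Free v)
                  (¬leaf : ∀ {u} → Free u → ¬ Leaf u) where

    continue : ∀ {e u v} → Free u → Link G e u v → ∃[ e′ ] Turn u e v e′ × (∃[ w ] Link G e′ v w)
    continue u-free l with leaf-or-turn l
    ... | inj₁ v-leaf   = contradiction (_ , v-leaf) (¬leaf (closed u-free (_ , l)))
    ... | inj₂ (e′ , t) = e′ , t , incident⇒link G (incident t)

    hexagon : ∀ {v₀} → Free v₀ → Hexagon v₀
    hexagon {v₀} free₀ with no-isolated v₀
    ... | v₁ , e₀ , l₀ with continue free₀ l₀ | closed free₀ (e₀ , l₀)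
    ... | e₁ , t₁ , v₂ , l₁ | free₁ with continue free₁ l₁ | closed free₁ (e₁ , l₁)
    ... | e₂ , t₂ , v₃ , l₂ | free₂ with continue free₂ l₂ | closed free₂ (e₂ , l₂)
    ... | e₃ , t₃ , v₄ , l₃ | free₃ with continue free₃ l₃ | closed free₃ (e₃ , l₃)
    ... | e₄ , t₄ , v₅ , l₄ | free₄ with continue free₄ l₄ | closed free₄ (e₄ , l₄)
    ... | e₅ , t₅ , v₆ , l₅ | free₅ with continue free₅ l₅
         | closes-up t₁ t₂ t₃ t₄ t₅ l₅
    ... | e₆ , t₀ , _ | refl with only t₀ e₀ (link⇒incidentˡ G l₀)
    -- Were the walk to return along `e₀`, then `e₅ ≡ e₀` would have the weight of `v₁`, one of its
    -- own ends.
    ... | inj₁ refl = contradiction (trans (next-edge t₅) (trans (next-vertex t₃ l₃) (next-edge t₂)))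
                        (link⇒wv≢weʳ l₀ ∘ sym)
    ... | inj₂ refl = record { t₀ = t₀ ; t₁ = t₁ ; t₂ = t₂ ; t₃ = t₃ ; t₄ = t₄ ; t₅ = t₅ }

  -- Walks from a leaf: the paths `P 3` and `P 6`

  data Trail (u₁ : V G) : Set where
    short : ∀ {e₁ u₂ e₂ u₃} → IsLeaf u₁ e₁ → Turn u₁ e₁ u₂ e₂ → Link G e₂ u₂ u₃ → IsLeaf u₃ e₂ → Trail u₁
    long  : ∀ {e₁ u₂ e₂ u₃ e₃ u₄ e₄ u₅ e₅ u₆} → IsLeaf u₁ e₁ →
            Turn u₁ e₁ u₂ e₂ → Turn u₂ e₂ u₃ e₃ → Turn u₃ e₃ u₄ e₄ → Turn u₄ e₄ u₅ e₅ →
            Link G e₅ u₅ u₆ → IsLeaf u₆ e₅ → Trail u₁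

  -- A walk from a leaf can end only after two or five edges: at any other length the end weights,
  -- being edge labels, clash with the period.
  trail : ∀ {u₁} → Leaf u₁ → Trail u₁
  trail {u₁} (e₁ , leaf₁@(i₁ , _)) with incident⇒link G i₁
  ... | u₂ , l₁ with leaf-or-turn l₁
  ... | inj₁ leaf₂ = contradiction (trans (leaf-weight leaf₁) (sym (leaf-weight leaf₂))) (link⇒wv≢wv l₁)
  ... | inj₂ (e₂ , t₂) with incident⇒link G (incident t₂)
  ... | u₃ , l₂ with leaf-or-turn l₂
  ... | inj₁ leaf₃ = short leaf₁ t₂ l₂ leaf₃
  ... | inj₂ (e₃ , t₃) with incident⇒link G (incident t₃)
  ... | u₄ , l₃ with leaf-or-turn l₃
  -- Here both leaves have the same weight, so their edges have the same label and coincide; then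
  -- `e₁` has the weight of its end `u₂`.
  ... | inj₁ leaf₄ = contradiction (trans (cong we e₁≡e₃) (next-edge t₃)) (link⇒wv≢weʳ l₁ ∘ sym)
    where
    e₁≡e₃ : e₁ ≡ e₃
    e₁≡e₃ = le-injective (trans (sym (leaf-weight leaf₁))
      (trans (sym (trans (next-vertex t₃ l₃) (next-edge t₂))) (leaf-weight leaf₄)))
  ... | inj₂ (e₄ , t₄) with incident⇒link G (incident t₄)
  ... | u₅ , l₄ = last (leaf-or-turn l₄)
    where
    w₄ : le e₁ ≡ le e₃ + le e₄
    w₄ = trans (sym (leaf-weight leaf₁))
      (trans (sym (trans (next-vertex t₃ l₃) (next-edge t₂))) (turn-weight t₄))
    w₂≡w₅ : wv u₂ ≡ wv u₅
    w₂≡w₅ = sym (trans (next-vertex t₄ l₄) (next-edge t₃))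
    last : IsLeaf u₅ e₄ ⊎ (∃[ e₅ ] Turn u₄ e₄ u₅ e₅) → Trail u₁
    -- As `u₂` and `u₅` have equal weights, the label of `e₄` exceeds that of `e₁`, which by `w₄` is
    -- at least that of `e₄`.
    last (inj₁ leaf₅) = contradiction
      (m≤n+m (le e₄) (le e₃))
      (<⇒≱ (subst (_< le e₄) w₄ (subst (le e₁ <_)
        (trans (sym (turn-weight t₂)) (trans w₂≡w₅ (leaf-weight leaf₅))) (m<m+n (le e₁) {le e₂} (s≤s z≤n)))))
    last (inj₂ (e₅ , t₅)) with incident⇒link G (incident t₅)
    ... | u₆ , l₅ with leaf-or-turn l₅
    ... | inj₁ leaf₆ = long leaf₁ t₂ t₃ t₄ t₅ l₅ leaf₆
    -- Going on past `u₆` would need an edge of label 0, but labels start at 1.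
    ... | inj₂ (e₆ , t₆) = case vanish (le e₁) (le e₂) (le e₃) (le e₄) (le e₅) (le e₆)
        w₄ (trans (sym (turn-weight t₂)) (trans w₂≡w₅ (turn-weight t₅)))
        (trans (sym (turn-weight t₃)) (trans (sym (trans (next-vertex t₅ l₅) (next-edge t₄))) (turn-weight t₆)))
        of λ ()
      where
      vanish : ∀ a b c d p q → a ≡ c + d → a + b ≡ d + p → b + c ≡ p + q → q ≡ 0
      vanish a b c d p q h₁ h₂ h₃ = +-cancelˡ-≡ (a + b + c + d + p) q 0 (begin
        (a + b + c + d + p) + q      ≡⟨ expandˡ a b c d p q ⟩
        (p + q) + (a + b) + (c + d)  ≡⟨ cong₂ _+_ (cong₂ _+_ (sym h₃) h₂) (sym h₁) ⟩
        (b + c) + (d + p) + a        ≡⟨ expandʳ a b c d p ⟩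
        (a + b + c + d + p) + 0      ∎)
        where
        open ≡-Reasoning
        expandˡ : ∀ a b c d p q → (a + b + c + d + p) + q ≡ (p + q) + (a + b) + (c + d)
        expandˡ = solve-∀
        expandʳ : ∀ a b c d p → (b + c) + (d + p) + a ≡ (a + b + c + d + p) + 0
        expandʳ = solve-∀

  P₃↪ : ∀ {x d y e z} → IsLeaf x d → Turn x d y e → Link G e y z → IsLeaf z e → P 3 ↪ G
  vmap (P₃↪ {x} {d} {y} {e} {z} x-leaf t l z-leaf) = lookup (x ∷ y ∷ z ∷ [])
  vmap-injective (P₃↪ x-leaf t l z-leaf) = lookup-injective
    ((one-apart (link t) ∷ two-apart t l ∷ []) ∷ (one-apart l ∷ []) ∷ [] ∷ [])
  forth (P₃↪ {d = d} {e = e} x-leaf t l z-leaf) 0F = d , link t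
  forth (P₃↪ {d = d} {e = e} x-leaf t l z-leaf) 1F = e , l
  back (P₃↪ x-leaf t l z-leaf) 0F adj with leaf-neighbour x-leaf (link t) adj
  ... | refl = 1F , refl , 0F , inj₁ (refl , refl)
  back (P₃↪ x-leaf t l z-leaf) 1F adj with turn-neighbours t l adj
  ... | inj₁ refl = 0F , refl , 0F , inj₂ (refl , refl)
  ... | inj₂ refl = 2F , refl , 1F , inj₁ (refl , refl)
  back (P₃↪ x-leaf t l z-leaf) 2F adj with leaf-neighbour z-leaf (link-sym G l) adj
  ... | refl = 1F , refl , 1F , inj₂ (refl , refl)

  module _ {u₁ e₁ u₂ e₂ u₃ e₃ u₄ e₄ u₅ e₅ u₆} (leaf₁ : IsLeaf u₁ e₁)
           (t₂ : Turn u₁ e₁ u₂ e₂) (t₃ : Turn u₂ e₂ u₃ e₃) (t₄ : Turn u₃ e₃ u₄ e₄) (t₅ : Turn u₄ e₄ u₅ e₅)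
           (l₅ : Link G e₅ u₅ u₆) (leaf₆ : IsLeaf u₆ e₅) where

    -- By the period, `u₆` has the weight of `e₁`, the edge at `u₁`.
    long-ends : wv u₁ ≢ wv u₆
    long-ends eq = link⇒wv≢we (link t₂)
      (trans eq (trans (next-vertex t₅ l₅) (trans (next-edge t₄) (next-vertex t₂ (link t₃)))))

    P₆↪ : P 6 ↪ G
    vmap P₆↪ = lookup (u₁ ∷ u₂ ∷ u₃ ∷ u₄ ∷ u₅ ∷ u₆ ∷ [])
    vmap-injective P₆↪ = lookup-injective
      ( (leaf≢turn leaf₁ t₂ ∷ leaf≢turn leaf₁ t₃ ∷ leaf≢turn leaf₁ t₄ ∷ leaf≢turn leaf₁ t₅ ∷ (long-ends ∘ cong wv) ∷ [])
      ∷ (one-apart (link t₃) ∷ two-apart t₃ (link t₄) ∷ three-apart t₃ t₄ t₅ ∷ leaf≢turn leaf₆ t₂ ∘ sym ∷ [])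
      ∷ (one-apart (link t₄) ∷ two-apart t₄ (link t₅) ∷ leaf≢turn leaf₆ t₃ ∘ sym ∷ [])
      ∷ (one-apart (link t₅) ∷ leaf≢turn leaf₆ t₄ ∘ sym ∷ [])
      ∷ (leaf≢turn leaf₆ t₅ ∘ sym ∷ []) ∷ [] ∷ [])
    forth P₆↪ 0F = e₁ , link t₂
    forth P₆↪ 1F = e₂ , link t₃
    forth P₆↪ 2F = e₃ , link t₄
    forth P₆↪ 3F = e₄ , link t₅
    forth P₆↪ 4F = e₅ , l₅
    back P₆↪ 0F adj with leaf-neighbour leaf₁ (link t₂) adj
    ... | refl = 1F , refl , 0F , inj₁ (refl , refl)
    back P₆↪ 1F adj with turn-neighbours t₂ (link t₃) adj
    ... | inj₁ refl = 0F , refl , 0F , inj₂ (refl , refl)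
    ... | inj₂ refl = 2F , refl , 1F , inj₁ (refl , refl)
    back P₆↪ 2F adj with turn-neighbours t₃ (link t₄) adj
    ... | inj₁ refl = 1F , refl , 1F , inj₂ (refl , refl)
    ... | inj₂ refl = 3F , refl , 2F , inj₁ (refl , refl)
    back P₆↪ 3F adj with turn-neighbours t₄ (link t₅) adj
    ... | inj₁ refl = 2F , refl , 2F , inj₂ (refl , refl)
    ... | inj₂ refl = 4F , refl , 3F , inj₁ (refl , refl)
    back P₆↪ 4F adj with turn-neighbours t₅ l₅ adj
    ... | inj₁ refl = 3F , refl , 3F , inj₂ (refl , refl)
    ... | inj₂ refl = 5F , refl , 4F , inj₁ (refl , refl)
    back P₆↪ 5F adj with leaf-neighbour leaf₆ (link-sym G l₅) adj
    ... | refl = 4F , refl , 4F , inj₂ (refl , refl)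

  -- What the count of leaves needs from either kind of path: a second leaf at its far end, with a
  -- different weight.
  record LeafPath (u : V G) : Set where
    field
      {n}        : ℕ
      embedding  : P (suc n) ↪ G
      start      : vmap embedding zero ≡ u
      {u′}       : V G
      end        : vmap embedding (fromℕ n) ≡ u′
      end-leaf   : Leaf u′
      ends≢      : wv u ≢ wv u′

  open LeafPath

  leaf-path : ∀ {u} → Trail u → LeafPath u
  leaf-path (short x-leaf t l z-leaf) = record
    { embedding = P₃↪ x-leaf t l z-leaf ; start = refl ; end = refl ; end-leaf = _ , z-leaf
    ; ends≢ = λ eq → link⇒wv≢we (link t) (trans eq (next-vertex t l)) }
  leaf-path (long leaf₁ t₂ t₃ t₄ t₅ l₅ leaf₆) = record
    { embedding = P₆↪ leaf₁ t₂ t₃ t₄ t₅ l₅ leaf₆ ; start = refl ; end = refl ; end-leaf = _ , leaf₆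
    ; ends≢ = long-ends leaf₁ t₂ t₃ t₄ t₅ l₅ leaf₆ }

  -- The weight of a leaf is the label of its edge, hence determines the leaf.
  leaf-weight-injective : ∀ {u v} → Leaf u → Leaf v → wv u ≡ wv v → u ≡ v
  leaf-weight-injective {u} {v} (d , u-leaf@(i , _)) (e , v-leaf@(j , _)) eq
    with le-injective (trans (sym (leaf-weight u-leaf)) (trans eq (leaf-weight v-leaf)))
  ... | refl with incident⇒link G i
  ... | w , l with link-ends G l j
  ... | inj₁ v≡u  = sym v≡u
  ... | inj₂ refl = contradiction eq (link⇒wv≢wv l)

  -- The path from `v` would avoid the one from `u`. Their four ends would be distinct leaves, and
  -- leaf weights are injective, so there would be four weights.
  no-leaf-outside : ∀ {u v} → Leaf u → (ψ : LeafPath u) → ¬ Image (embedding ψ) v → ¬ Leaf v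
  no-leaf-outside {u} {v} u-leaf ψ v∉ v-leaf = ¬four-weights
    (v∈ u ∷ v∈ (u′ ψ) ∷ v∈ v ∷ v∈ (u′ χ) ∷ [])
    ( (ends≢ ψ ∷ v∉ ∘ at-start v-leaf ∷ v′∉ ∘ at-start (end-leaf χ) ∷ [])
    ∷ (v∉ ∘ at-end v-leaf ∷ v′∉ ∘ at-end (end-leaf χ) ∷ [])
    ∷ (ends≢ χ ∷ []) ∷ [] ∷ [])
    where
    χ : LeafPath v
    χ = leaf-path (trail v-leaf)
    v′∉ : ¬ Image (embedding ψ) (u′ χ)
    v′∉ = subst (¬_ ∘ Image (embedding ψ)) (end χ)
      (path-connected (¬_ ∘ Image (embedding ψ)) (outside-closed (embedding ψ)) (embedding χ)
        (subst (¬_ ∘ Image (embedding ψ)) (sym (start χ)) v∉) _)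
    at-start : ∀ {x} → Leaf x → wv u ≡ wv x → Image (embedding ψ) x
    at-start x-leaf eq = zero , trans (start ψ) (leaf-weight-injective u-leaf x-leaf eq)
    at-end : ∀ {x} → Leaf x → wv (u′ ψ) ≡ wv x → Image (embedding ψ) x
    at-end x-leaf eq = fromℕ _ , trans (end ψ) (leaf-weight-injective (end-leaf ψ) x-leaf eq)

  -- Assembling the components

  Conclusion : Set
  Conclusion = (G ≅ P 3) ⊎ (G ≅ P 6) ⊎ (∃[ m ] (m ≥ 1 × G ≅ m · C 6)) ⊎ (∃[ m ] G ≅ m · C 6 ⊕ P 6)

  some-vertex : V G
  some-vertex = fromℕ< (≤-trans (s≤s z≤n) order≥3)

  hexagons-only : HexagonCover G (λ _ → ⊤) → Conclusion
  hexagons-only (zero  , φ , _ , onto) = ⊥-elim (Finₚ.¬Fin0 (proj₁ (onto some-vertex tt)))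
  hexagons-only (suc m , φ , _ , onto) = inj₂ (inj₂ (inj₁ (suc m , s≤s z≤n , onto⇒≅ φ (λ v → onto v tt))))

  without-leaves : (∀ u → ¬ Leaf u) → Conclusion
  without-leaves ¬leaf = hexagons-only (hexagon-cover (λ _ → yes tt) (λ _ _ → tt) hexagon-at)
    where
    open Leafless (λ _ → ⊤) (λ _ _ → tt) (λ {u} _ → ¬leaf u)
    hexagon-at : ∀ v → ⊤ → Σ[ ψ ∈ C 6 ↪ G ] vmap ψ zero ≡ v
    hexagon-at v _ = hexagon↪ (hexagon {v} tt) , refl

  path-and-hexagons : (ψ : P 6 ↪ G) → HexagonCover G (¬_ ∘ Image ψ) → Conclusion
  path-and-hexagons ψ (m , φ , outside , onto) =
    inj₂ (inj₂ (inj₂ (m , onto⇒≅ (glue φ ψ disjoint) glue-onto)))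
    where
    disjoint : ∀ x y → vmap φ x ≢ vmap ψ y
    disjoint x y eq = outside x (y , sym eq)
    glue-onto : ∀ v → Image (glue φ ψ disjoint) v
    glue-onto v with image? ψ v
    ... | yes v∈ = glue-right φ ψ disjoint v∈
    ... | no  v∉ = glue-left φ ψ disjoint (onto v v∉)

  module Beyond {u : V G} (u-leaf : Leaf u) (ψ : LeafPath u) =
    Leafless (¬_ ∘ Image (embedding ψ)) (outside-closed (embedding ψ)) (no-leaf-outside u-leaf ψ)

  with-leaf : ∀ {u} → Trail u → Conclusion
  with-leaf τ@(short {d} x-leaf t l z-leaf) = inj₁ (onto⇒≅ ψ λ v → decidable-stable (image? ψ v)
    λ v∉ → ¬hexagon-and-P₃ (hexagon v∉) x-leaf t l z-leaf)
    where
    ψ = P₃↪ x-leaf t l z-leaf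
    open Beyond (d , x-leaf) (leaf-path τ)
  with-leaf τ@(long {e₁} leaf₁ t₂ t₃ t₄ t₅ l₅ leaf₆) = path-and-hexagons (P₆↪ leaf₁ t₂ t₃ t₄ t₅ l₅ leaf₆)
    (hexagon-cover (λ v → ¬? (image? ψ v)) (outside-closed ψ) hexagon-at)
    where
    ψ = P₆↪ leaf₁ t₂ t₃ t₄ t₅ l₅ leaf₆
    open Beyond (e₁ , leaf₁) (leaf-path τ)
    hexagon-at : ∀ v → ¬ Image ψ v → Σ[ χ ∈ C 6 ↪ G ] vmap χ zero ≡ v
    hexagon-at v v∉ = hexagon↪ (hexagon {v} v∉) , refl

  conclusion : Conclusion
  conclusion with any? leaf?
  ... | yes (u , u-leaf) = with-leaf (trail u-leaf)
  ... | no none          = without-leaves (λ u u-leaf → none (u , u-leaf))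

-- Labellings of hexagons and paths

Element : Graph → Set
Element G = V G ⊎ E G

emb : ∀ {H G} → H ↪ G → Element H → Element G
emb ψ = Sum.map (vmap ψ) (emap ψ)

module _ (G : Graph) (lab : Element G → ℕ) (col : Element G → Fin 3) (W : Fin 3 → ℕ) where

  -- A local certificate: it lists the edges at `u`, evaluates the weight through `W` and states the
  -- inequalities for colours. Being local, it can be carried along embeddings.
  data Around (u : V G) : Set where
    leaf : ∀ e → Incident G u e → (∀ d → Incident G u d → d ≡ e) →
           W (col (inj₁ u)) ≡ lab (inj₂ e) → col (inj₁ u) ≢ col (inj₂ e) → Around u
    turn : ∀ e e′ → Incident G u e → Incident G u e′ → (∀ d → Incident G u d → d ≡ e ⊎ d ≡ e′) →
           W (col (inj₁ u)) ≡ lab (inj₂ e) + lab (inj₂ e′) →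
           col (inj₁ u) ≢ col (inj₂ e) → col (inj₁ u) ≢ col (inj₂ e′) → col (inj₂ e) ≢ col (inj₂ e′) → Around u

  data Along (e : E G) : Set where
    edge : W (col (inj₂ e)) ≡ lab (inj₁ (src G e)) + lab (inj₁ (tgt G e)) →
           col (inj₁ (src G e)) ≢ col (inj₁ (tgt G e)) → Along e

-- The colour of a vertex or an edge records its weight: elements of colour κ have weight W κ.
record Pattern (G : Graph) (W : Fin 3 → ℕ) : Set where
  field
    lab           : Element G → ℕ
    col           : Element G → Fin 3
    around        : ∀ u → Around G lab col W u
    along         : ∀ e → Along G lab col W e
    lab-injective : ∀ {x y} → lab x ≡ lab y → x ≡ y

open Pattern

-- Patterns under embeddings, disjoint unions and isomorphisms

module _ {G : Graph} {W : Fin 3 → ℕ} {lab lab′ : Element G → ℕ} {col col′ : Element G → Fin 3}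
         (lab≗ : ∀ z → lab z ≡ lab′ z) (col≗ : ∀ z → col z ≡ col′ z) where

  private
    ≢-resp : ∀ {x y} → col x ≢ col y → col′ x ≢ col′ y
    ≢-resp {x} {y} x≢y eq = x≢y (trans (col≗ x) (trans eq (sym (col≗ y))))

  around-resp : ∀ {u} → Around G lab col W u → Around G lab′ col′ W u
  around-resp {u} (leaf e i only eq u≢e) =
    leaf e i only (trans (cong W (sym (col≗ _))) (trans eq (lab≗ _))) (≢-resp u≢e)
  around-resp {u} (turn e e′ i i′ only eq u≢e u≢e′ e≢e′) =
    turn e e′ i i′ only (trans (cong W (sym (col≗ _))) (trans eq (cong₂ _+_ (lab≗ _) (lab≗ _))))
      (≢-resp u≢e) (≢-resp u≢e′) (≢-resp e≢e′)

  along-resp : ∀ {e} → Along G lab col W e → Along G lab′ col′ W e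
  along-resp (edge eq s≢t) =
    edge (trans (cong W (sym (col≗ _))) (trans eq (cong₂ _+_ (lab≗ _) (lab≗ _)))) (≢-resp s≢t)

module _ {H G : Graph} (ψ : H ↪ G) where

  incident-emb : ∀ {x e} → Incident H x e → Incident G (vmap ψ x) (emap ψ e)
  incident-emb i = link⇒incidentˡ G (emap-link ψ (proj₂ (incident⇒link H i)))

  -- `back` supplies an edge of `H` over the ends of `d`, and simplicity identifies its image with
  -- `d`.
  incident-emb⁻ : ∀ {x d} → Incident G (vmap ψ x) d → ∃[ e ] emap ψ e ≡ d × Incident H x e
  incident-emb⁻ {x} {d} i with incident⇒link G i
  ... | w , l with back ψ x (d , l)
  ... | y , refl , e , l′ = e , simple G (emap-link ψ l′) l , link⇒incidentˡ H l′

  module _ {lab : Element G → ℕ} {col : Element G → Fin 3} {W : Fin 3 → ℕ} where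

    around-emb : ∀ {x} → Around H (lab ∘ emb ψ) (col ∘ emb ψ) W x → Around G lab col W (vmap ψ x)
    around-emb {x} (leaf e i only eq u≢e) = leaf (emap ψ e) (incident-emb i) only′ eq u≢e
      where
      only′ : ∀ d → Incident G (vmap ψ x) d → d ≡ emap ψ e
      only′ d j with incident-emb⁻ j
      ... | e₁ , refl , k = cong (emap ψ) (only e₁ k)
    around-emb {x} (turn e e′ i i′ only eq u≢e u≢e′ e≢e′) =
      turn (emap ψ e) (emap ψ e′) (incident-emb i) (incident-emb i′) only′ eq u≢e u≢e′ e≢e′
      where
      only′ : ∀ d → Incident G (vmap ψ x) d → d ≡ emap ψ e ⊎ d ≡ emap ψ e′
      only′ d j with incident-emb⁻ j
      ... | e₁ , refl , k = Sum.map (cong (emap ψ)) (cong (emap ψ)) (only e₁ k)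

    along-emb : ∀ {e} → Along H (lab ∘ emb ψ) (col ∘ emb ψ) W e → Along G lab col W (emap ψ e)
    along-emb {e} (edge eq s≢t) = edge (proj₁ ends) (proj₂ ends)
      where
      ends : W (col (inj₂ (emap ψ e))) ≡ lab (inj₁ (src G (emap ψ e))) + lab (inj₁ (tgt G (emap ψ e))) ×
             col (inj₁ (src G (emap ψ e))) ≢ col (inj₁ (tgt G (emap ψ e)))
      ends with proj₂ (forth ψ e)
      ... | inj₁ (p , q) rewrite p | q = eq , s≢t
      ... | inj₂ (p , q) rewrite p | q = trans eq (+-comm (lab (inj₁ (vmap ψ (src H e)))) _) , s≢t ∘ sym

module _ {H K : Graph} {W : Fin 3 → ℕ} (p : Pattern H W) (q : Pattern K W) where

  private
    on-elements : ∀ {A : Set} → (Element H → A) → (Element K → A) → Element (H ⊕ K) → A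
    on-elements g h = [ copair (g ∘ inj₁) (h ∘ inj₁) , copair (g ∘ inj₂) (h ∘ inj₂) ]′

    on-left : ∀ {A : Set} (g : Element H → A) (h : Element K → A) x → on-elements g h (emb (inl↪ H K) x) ≡ g x
    on-left g h (inj₁ u) = copair-↑ˡ (g ∘ inj₁) (h ∘ inj₁) u
    on-left g h (inj₂ e) = copair-↑ˡ (g ∘ inj₂) (h ∘ inj₂) e

    on-right : ∀ {A : Set} (g : Element H → A) (h : Element K → A) y → on-elements g h (emb (inr↪ H K) y) ≡ h y
    on-right g h (inj₁ u) = copair-↑ʳ (g ∘ inj₁) (h ∘ inj₁) u
    on-right g h (inj₂ e) = copair-↑ʳ (g ∘ inj₂) (h ∘ inj₂) e

    element-split : ∀ z → (∃[ x ] emb (inl↪ H K) x ≡ z) ⊎ (∃[ y ] emb (inr↪ H K) y ≡ z)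
    element-split (inj₁ u) with split (order H) u
    ... | left i  = inj₁ (inj₁ i , refl)
    ... | right j = inj₂ (inj₁ j , refl)
    element-split (inj₂ e) with split (size H) e
    ... | left i  = inj₁ (inj₂ i , refl)
    ... | right j = inj₂ (inj₂ j , refl)

    lab⊕ : Element (H ⊕ K) → ℕ
    lab⊕ = on-elements (lab p) (lab q)

    col⊕ : Element (H ⊕ K) → Fin 3
    col⊕ = on-elements (col p) (col q)

  module _ (disjoint : ∀ x y → lab p x ≢ lab q y) where

    -- Both summands share `W`, which keeps the union at the same three weights.
    pattern-⊕ : Pattern (H ⊕ K) W
    lab pattern-⊕ = lab⊕
    col pattern-⊕ = col⊕
    around pattern-⊕ u with split (order H) u
    ... | left i  = around-emb (inl↪ H K) (around-resp
      (λ z → sym (on-left (lab p) (lab q) z)) (λ z → sym (on-left (col p) (col q) z)) (around p i))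
    ... | right j = around-emb (inr↪ H K) (around-resp
      (λ z → sym (on-right (lab p) (lab q) z)) (λ z → sym (on-right (col p) (col q) z)) (around q j))
    along pattern-⊕ e with split (size H) e
    ... | left i  = along-emb (inl↪ H K) (along-resp
      (λ z → sym (on-left (lab p) (lab q) z)) (λ z → sym (on-left (col p) (col q) z)) (along p i))
    ... | right j = along-emb (inr↪ H K) (along-resp
      (λ z → sym (on-right (lab p) (lab q) z)) (λ z → sym (on-right (col p) (col q) z)) (along q j))
    lab-injective pattern-⊕ {z} {z′} eq with element-split z | element-split z′
    ... | inj₁ (x , refl) | inj₁ (y , refl) = cong (emb (inl↪ H K)) (lab-injective p
      (trans (sym (on-left (lab p) (lab q) x)) (trans eq (on-left (lab p) (lab q) y))))
    ... | inj₁ (x , refl) | inj₂ (y , refl) = contradiction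
      (trans (sym (on-left (lab p) (lab q) x)) (trans eq (on-right (lab p) (lab q) y))) (disjoint x y)
    ... | inj₂ (x , refl) | inj₁ (y , refl) = contradiction
      (trans (sym (on-left (lab p) (lab q) y)) (trans (sym eq) (on-right (lab p) (lab q) x))) (disjoint y x)
    ... | inj₂ (x , refl) | inj₂ (y , refl) = cong (emb (inr↪ H K)) (lab-injective q
      (trans (sym (on-right (lab p) (lab q) x)) (trans eq (on-right (lab p) (lab q) y))))

    pattern-⊕-labels : ∀ {Q : ℕ → Set} → (∀ x → Q (lab p x)) → (∀ y → Q (lab q y)) →
                       ∀ z → Q (lab pattern-⊕ z)
    pattern-⊕-labels {Q} inH inK z with element-split z
    ... | inj₁ (x , refl) = subst Q (sym (on-left (lab p) (lab q) x)) (inH x)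
    ... | inj₂ (y , refl) = subst Q (sym (on-right (lab p) (lab q) y)) (inK y)

-- Both edges join the same two ends, so simplicity identifies them.
emap-inverse : ∀ {G H} (φ : G ↪ H) (ψ : H ↪ G) → (∀ x → vmap φ (vmap ψ x) ≡ x) →
               ∀ e → emap φ (emap ψ e) ≡ e
emap-inverse {G} {H} φ ψ inverse e = simple H
  (subst₂ (Link H (emap φ (emap ψ e))) (inverse (src H e)) (inverse (tgt H e)) (emap-link φ (emap-link ψ (link-of H e))))
  (link-of H e)

module _ {G H : Graph} (i : G ≅ H) where

  private
    φ : G ↪ H
    φ = ≅⇒↪ {G} {H} i
    ψ : H ↪ G
    ψ = ≅⇒↪ {H} {G} (≅-sym {G} {H} i)
    φψ : ∀ x → vmap φ (vmap ψ x) ≡ x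
    φψ = Inverse.strictlyInverseˡ (proj₁ i)
    ψφ : ∀ x → vmap ψ (vmap φ x) ≡ x
    ψφ = Inverse.strictlyInverseʳ (proj₁ i)

    emb-φψ : ∀ z → emb φ (emb ψ z) ≡ z
    emb-φψ (inj₁ x) = cong inj₁ (φψ x)
    emb-φψ (inj₂ e) = cong inj₂ (emap-inverse φ ψ φψ e)

    emb-ψφ : ∀ z → emb ψ (emb φ z) ≡ z
    emb-ψφ (inj₁ x) = cong inj₁ (ψφ x)
    emb-ψφ (inj₂ e) = cong inj₂ (emap-inverse ψ φ ψφ e)

  ≅⇒total≡ : order G + size G ≡ order H + size H
  ≅⇒total≡ = cong₂ _+_ (↔⇒≡ (proj₁ i)) (↔⇒≡ (mk↔ₛ′ (emap φ) (emap ψ) (emap-inverse φ ψ φψ) (emap-inverse ψ φ ψφ)))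

  -- The second component passes any property of all labels, such as their range, on to the
  -- transported pattern.
  pattern-≅ : ∀ {W} (p : Pattern H W) →
              Σ[ q ∈ Pattern G W ] (∀ {Q : ℕ → Set} → (∀ x → Q (lab p x)) → ∀ z → Q (lab q z))
  pattern-≅ {W} p = q , λ all z → all (emb φ z)
    where
    q : Pattern G W
    lab q = lab p ∘ emb φ
    col q = col p ∘ emb φ
    around q u = subst (Around G (lab q) (col q) W) (ψφ u) (around-emb ψ
      (around-resp (λ z → cong (lab p) (sym (emb-φψ z))) (λ z → cong (col p) (sym (emb-φψ z))) (around p (vmap φ u))))
    along q e = subst (Along G (lab q) (col q) W) (emap-inverse ψ φ ψφ e) (along-emb ψ
      (along-resp (λ z → cong (lab p) (sym (emb-φψ z))) (λ z → cong (col p) (sym (emb-φψ z))) (along p (emap φ e))))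
    lab-injective q {x} {y} eq =
      trans (sym (emb-ψφ x)) (trans (cong (emb ψ) (lab-injective p eq)) (emb-ψφ y))

-- Explicit labels for hexagons and for the paths `P 6` and `P 3`

left-inverse⇒injective : ∀ {A B : Set} {g : A → B} (h : B → A) → (∀ x → h (g x) ≡ x) →
                         ∀ {x y} → g x ≡ g y → x ≡ y
left-inverse⇒injective h inverse eq = trans (sym (inverse _)) (trans (cong h eq) (inverse _))

-- The twelve labels of a hexagon form a low and a high run of six consecutive numbers.
Slot : Set
Slot = Fin 6 ⊎ Fin 6

place : ℕ → ℕ → Slot → ℕ
place b h = [ (λ i → b + toℕ i) , (λ j → b + (h + toℕ j)) ]′

-- The three weights are `Z + 6`, `Z + 5` and `Z + 4`, where `Z` will be the sum `b + (b + h)` of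
-- the starts of the two runs.
weight : ℕ → Fin 3 → ℕ
weight Z κ = Z + (6 ∸ toℕ κ)

weight-injective : ∀ Z {κ κ′} → weight Z κ ≡ weight Z κ′ → κ ≡ κ′
weight-injective Z {κ} {κ′} eq = toℕ-injective (∸-cancelˡ-≡ (bound κ) (bound κ′) (+-cancelˡ-≡ Z _ _ eq))
  where
  bound : ∀ (κ : Fin 3) → toℕ κ ≤ 6
  bound κ = ≤-trans (<⇒≤ (toℕ<n κ)) (s≤s (s≤s (s≤s z≤n)))

-- Read in the order edge 0, vertex 0, edge 1, vertex 1 and so on, the colours run cyclically
-- through 0, 1, 2.
hexagon-col : Element (C 6) → Fin 3
hexagon-col = [ lookup (1F ∷ 0F ∷ 2F ∷ 1F ∷ 0F ∷ 2F ∷ []) , lookup (0F ∷ 2F ∷ 1F ∷ 0F ∷ 2F ∷ 1F ∷ []) ]′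

-- Labels at distance two along the hexagon lie in different runs and have colours κ ≠ κ′,
-- and their offsets add up to 3 + κ + κ′ = 6 ∸ κ″, where κ″ is the colour between them.
hexagon-slot : Element (C 6) → Slot
hexagon-slot =
  [ lookup (inj₁ 4F ∷ inj₂ 0F ∷ inj₁ 5F ∷ inj₂ 1F ∷ inj₁ 3F ∷ inj₂ 2F ∷ [])
  , lookup (inj₁ 0F ∷ inj₂ 5F ∷ inj₁ 1F ∷ inj₂ 3F ∷ inj₁ 2F ∷ inj₂ 4F ∷ []) ]′

hexagon-slot⁻ : Slot → Element (C 6)
hexagon-slot⁻ =
  [ lookup (inj₂ 0F ∷ inj₂ 2F ∷ inj₂ 4F ∷ inj₁ 4F ∷ inj₁ 0F ∷ inj₁ 2F ∷ [])
  , lookup (inj₁ 1F ∷ inj₁ 3F ∷ inj₁ 5F ∷ inj₂ 3F ∷ inj₂ 5F ∷ inj₂ 1F ∷ []) ]′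

hexagon-slot-injective : ∀ {x y} → hexagon-slot x ≡ hexagon-slot y → x ≡ y
hexagon-slot-injective = left-inverse⇒injective hexagon-slot⁻ inverse
  where
  inverse : ∀ x → hexagon-slot⁻ (hexagon-slot x) ≡ x
  inverse (inj₁ u) = from-yes (all? (λ u → ≡-dec Fin._≟_ Fin._≟_ (hexagon-slot⁻ (hexagon-slot (inj₁ u))) (inj₁ u))) u
  inverse (inj₂ e) = from-yes (all? (λ e → ≡-dec Fin._≟_ Fin._≟_ (hexagon-slot⁻ (hexagon-slot (inj₂ e))) (inj₂ e))) e

-- P 6 is the hexagon without its closing edge.
P₆⊂C₆ : Element (P 6) → Element (C 6)
P₆⊂C₆ = Sum.map id suc

next₆ : Fin 6 → Fin 6
next₆ = lookup (1F ∷ 2F ∷ 3F ∷ 4F ∷ 5F ∷ 0F ∷ [])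

edges-at-C₆ : ∀ u d → Incident (C 6) u d → d ≡ u ⊎ d ≡ next₆ u
edges-at-C₆ = from-yes (all? λ u → all? λ d → incident? (C 6) u d →-dec ((d Fin.≟ u) ⊎-dec (d Fin.≟ next₆ u)))

first-edge-P₆ : ∀ d → Incident (P 6) 0F d → d ≡ 0F
first-edge-P₆ = from-yes (all? λ d → incident? (P 6) 0F d →-dec (d Fin.≟ 0F))

inner-edges-P₆ : ∀ (i : Fin 4) d → Incident (P 6) (suc (inject₁ i)) d → d ≡ inject₁ i ⊎ d ≡ suc i
inner-edges-P₆ = from-yes (all? λ i → all? λ d →
  incident? (P 6) (suc (inject₁ i)) d →-dec ((d Fin.≟ inject₁ i) ⊎-dec (d Fin.≟ suc i)))

last-edge-P₆ : ∀ d → Incident (P 6) 5F d → d ≡ 4F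
last-edge-P₆ = from-yes (all? λ d → incident? (P 6) 5F d →-dec (d Fin.≟ 4F))

-- The bound `6 ≤ h` keeps the two runs from overlapping.
place-injective : ∀ {b h} → 6 ≤ h → ∀ {s t} → place b h s ≡ place b h t → s ≡ t
place-injective {b} {h} 6≤h {inj₁ i} {inj₁ j} eq = cong inj₁ (toℕ-injective (+-cancelˡ-≡ b _ _ eq))
place-injective {b} {h} 6≤h {inj₂ i} {inj₂ j} eq =
  cong inj₂ (toℕ-injective (+-cancelˡ-≡ h _ _ (+-cancelˡ-≡ b _ _ eq)))
place-injective {b} {h} 6≤h {inj₁ i} {inj₂ j} eq = contradiction (+-cancelˡ-≡ b _ _ eq)
  (<⇒≢ (≤-trans (toℕ<n i) (≤-trans 6≤h (m≤m+n h (toℕ j)))))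
place-injective {b} {h} 6≤h {inj₂ i} {inj₁ j} eq = contradiction (sym (+-cancelˡ-≡ b _ _ eq))
  (<⇒≢ (≤-trans (toℕ<n j) (≤-trans 6≤h (m≤m+n h (toℕ i)))))

place<b+6+h : ∀ b h s → place b h s < b + (6 + h)
place<b+6+h b h (inj₁ i) = +-monoʳ-< b (≤-trans (toℕ<n i) (m≤m+n 6 h))
place<b+6+h b h (inj₂ j) = +-monoʳ-< b (≤-trans (+-monoʳ-< h (toℕ<n j)) (≤-reflexive (+-comm h 6)))

b≤place : ∀ b h s → b ≤ place b h s
b≤place b h (inj₁ i) = m≤m+n b _
b≤place b h (inj₂ j) = m≤m+n b _

-- The gap between the two runs is where the remaining components get their labels.
place-skips : ∀ b h s {x} → b + 6 ≤ x → x < b + h → place b h s ≢ x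
place-skips b h (inj₁ i) lo _  refl = <⇒≱ (+-monoʳ-< b (toℕ<n i)) lo
place-skips b h (inj₂ j) _  hi refl = <⇒≱ hi (+-monoʳ-≤ b (m≤m+n h (toℕ j)))

low+high : ∀ b h i j → (b + (b + h)) + (i + j) ≡ (b + i) + (b + (h + j))
low+high = solve-∀

high+low : ∀ b h i j → (b + (b + h)) + (i + j) ≡ (b + (h + i)) + (b + j)
high+low = solve-∀

module _ (b h : ℕ) (6≤h : 6 ≤ h) where

  hexagon-pattern : Pattern (C 6) (weight (b + (b + h)))
  lab hexagon-pattern = place b h ∘ hexagon-slot
  col hexagon-pattern = hexagon-col
  -- The numerals are the offsets of the two labels in their runs; their sum computes to 6 minus the
  -- colour.
  around hexagon-pattern 0F = turn 0F 1F (inj₂ refl) (inj₁ refl) (edges-at-C₆ 0F) (low+high b h 0 5) (λ ()) (λ ()) (λ ())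
  around hexagon-pattern 1F = turn 1F 2F (inj₂ refl) (inj₁ refl) (edges-at-C₆ 1F) (high+low b h 5 1) (λ ()) (λ ()) (λ ())
  around hexagon-pattern 2F = turn 2F 3F (inj₂ refl) (inj₁ refl) (edges-at-C₆ 2F) (low+high b h 1 3) (λ ()) (λ ()) (λ ())
  around hexagon-pattern 3F = turn 3F 4F (inj₂ refl) (inj₁ refl) (edges-at-C₆ 3F) (high+low b h 3 2) (λ ()) (λ ()) (λ ())
  around hexagon-pattern 4F = turn 4F 5F (inj₂ refl) (inj₁ refl) (edges-at-C₆ 4F) (low+high b h 2 4) (λ ()) (λ ()) (λ ())
  around hexagon-pattern 5F = turn 5F 0F (inj₂ refl) (inj₁ refl) (edges-at-C₆ 5F) (high+low b h 4 0) (λ ()) (λ ()) (λ ())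
  along hexagon-pattern 0F = edge (high+low b h 2 4) (λ ())
  along hexagon-pattern 1F = edge (low+high b h 4 0) (λ ())
  along hexagon-pattern 2F = edge (high+low b h 0 5) (λ ())
  along hexagon-pattern 3F = edge (low+high b h 5 1) (λ ())
  along hexagon-pattern 4F = edge (high+low b h 1 3) (λ ())
  along hexagon-pattern 5F = edge (low+high b h 3 2) (λ ())
  lab-injective hexagon-pattern {x} {y} eq = hexagon-slot-injective {x} {y} (place-injective 6≤h eq)

-- With b = 0 the closing edge carries the label 0 and can be dropped without changing any weight.
P₆-pattern : ∀ h → 6 ≤ h → Pattern (P 6) (weight h)
lab (P₆-pattern h 6≤h) = place 0 h ∘ hexagon-slot ∘ P₆⊂C₆
col (P₆-pattern h 6≤h) = hexagon-col ∘ P₆⊂C₆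
around (P₆-pattern h 6≤h) 0F = leaf 0F (inj₁ refl) first-edge-P₆ refl (λ ())
around (P₆-pattern h 6≤h) 1F = turn 0F 1F (inj₂ refl) (inj₁ refl) (inner-edges-P₆ 0F) (high+low 0 h 5 1) (λ ()) (λ ()) (λ ())
around (P₆-pattern h 6≤h) 2F = turn 1F 2F (inj₂ refl) (inj₁ refl) (inner-edges-P₆ 1F) (low+high 0 h 1 3) (λ ()) (λ ()) (λ ())
around (P₆-pattern h 6≤h) 3F = turn 2F 3F (inj₂ refl) (inj₁ refl) (inner-edges-P₆ 2F) (high+low 0 h 3 2) (λ ()) (λ ()) (λ ())
around (P₆-pattern h 6≤h) 4F = turn 3F 4F (inj₂ refl) (inj₁ refl) (inner-edges-P₆ 3F) (low+high 0 h 2 4) (λ ()) (λ ()) (λ ())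
around (P₆-pattern h 6≤h) 5F = leaf 4F (inj₂ refl) last-edge-P₆ refl (λ ())
along (P₆-pattern h 6≤h) 0F = edge (low+high 0 h 4 0) (λ ())
along (P₆-pattern h 6≤h) 1F = edge (high+low 0 h 0 5) (λ ())
along (P₆-pattern h 6≤h) 2F = edge (low+high 0 h 5 1) (λ ())
along (P₆-pattern h 6≤h) 3F = edge (high+low 0 h 1 3) (λ ())
along (P₆-pattern h 6≤h) 4F = edge (low+high 0 h 3 2) (λ ())
lab-injective (P₆-pattern h 6≤h) {x} {y} eq = P₆⊂C₆-injective x y (hexagon-slot-injective (place-injective {0} 6≤h eq))
  where
  P₆⊂C₆-injective : ∀ x y → P₆⊂C₆ x ≡ P₆⊂C₆ y → x ≡ y
  P₆⊂C₆-injective (inj₁ _) (inj₁ _) refl = refl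
  P₆⊂C₆-injective (inj₂ _) (inj₂ _) refl = refl

-- Vertex labels 2, 1, 4 and edge labels 5, 3 give vertex weights 5, 8, 3 and edge weights 3, 5.
weight-P₃ : Fin 3 → ℕ
weight-P₃ = lookup (5 ∷ 3 ∷ 8 ∷ [])

P₃-pattern : Pattern (P 3) weight-P₃
lab P₃-pattern = [ lookup (2 ∷ 1 ∷ 4 ∷ []) , lookup (5 ∷ 3 ∷ []) ]′
col P₃-pattern = [ lookup (0F ∷ 2F ∷ 1F ∷ []) , lookup (1F ∷ 0F ∷ []) ]′
around P₃-pattern 0F = leaf 0F (inj₁ refl) (from-yes (all? λ d → incident? (P 3) 0F d →-dec (d Fin.≟ 0F))) refl (λ ())
around P₃-pattern 1F = turn 0F 1F (inj₂ refl) (inj₁ refl)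
  (from-yes (all? λ d → incident? (P 3) 1F d →-dec ((d Fin.≟ 0F) ⊎-dec (d Fin.≟ 1F)))) refl (λ ()) (λ ()) (λ ())
around P₃-pattern 2F = leaf 1F (inj₂ refl) (from-yes (all? λ d → incident? (P 3) 2F d →-dec (d Fin.≟ 1F))) refl (λ ())
along P₃-pattern 0F = edge refl (λ ())
along P₃-pattern 1F = edge refl (λ ())
lab-injective P₃-pattern = left-inverse⇒injective element inverse
  where
  element : ℕ → Element (P 3)
  element 1 = inj₁ 1F
  element 2 = inj₁ 0F
  element 3 = inj₂ 1F
  element 4 = inj₁ 2F
  element _ = inj₂ 0F
  inverse : ∀ x → element (lab P₃-pattern x) ≡ x
  inverse (inj₁ 0F) = refl
  inverse (inj₁ 1F) = refl
  inverse (inj₁ 2F) = refl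
  inverse (inj₂ 0F) = refl
  inverse (inj₂ 1F) = refl

Within : ℕ → ℕ → ℕ → Set
Within lo hi x = lo ≤ x × x < hi

∅-pattern : ∀ {W} → Pattern ∅ W
lab ∅-pattern = [ (λ ()) , (λ ()) ]′
col ∅-pattern = [ (λ ()) , (λ ()) ]′
around ∅-pattern ()
along ∅-pattern ()
lab-injective ∅-pattern {inj₁ ()}
lab-injective ∅-pattern {inj₂ ()}

-- The hexagons are nested: the outer one takes the six lowest and the six highest labels.
module _ (m b : ℕ) where

  private
    h Z : ℕ
    h = 6 + m * 12
    Z = b + (b + h)

  nest : (p : Pattern (m · C 6) (weight Z)) → (∀ z → Within (b + 6) (b + 6 + m * 12) (lab p z)) →
         Σ[ q ∈ Pattern (suc m · C 6) (weight Z) ] (∀ z → Within b (b + suc m * 12) (lab q z))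
  nest inner within = pattern-⊕ outer inner disjoint ,
    pattern-⊕-labels outer inner disjoint {Within b (b + suc m * 12)}
      (λ x → b≤place b h (hexagon-slot x) , place<b+6+h b h (hexagon-slot x))
      (λ y → ≤-trans (m≤m+n b 6) (proj₁ (within y)) , ≤-trans (below-h y) (+-monoʳ-≤ b (m≤n+m h 6)))
    where
    outer : Pattern (C 6) (weight Z)
    outer = hexagon-pattern b h (m≤m+n 6 (m * 12))
    below-h : ∀ y → lab inner y < b + h
    below-h y = ≤-trans (proj₂ (within y)) (≤-reflexive (+-assoc b 6 (m * 12)))
    disjoint : ∀ x y → lab outer x ≢ lab inner y
    disjoint x y = place-skips b h (hexagon-slot x) (proj₁ (within y)) (below-h y)

-- One step inwards raises `b` by 6 and lowers `m * 12` by 12, so `Z` stays fixed and all hexagons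
-- share their weights. Writing `Z + 6` avoids truncated subtraction.
hexagons-pattern : ∀ m b Z → Z + 6 ≡ b + (b + m * 12) →
                   Σ[ p ∈ Pattern (m · C 6) (weight Z) ] (∀ z → Within b (b + m * 12) (lab p z))
hexagons-pattern zero    b Z eq = ∅-pattern , λ { (inj₁ ()) ; (inj₂ ()) }
hexagons-pattern (suc m) b Z eq with +-cancelʳ-≡ 6 Z (b + (b + (6 + m * 12))) (trans eq (shift b (m * 12)))
  where
  shift : ∀ b k → b + (b + (12 + k)) ≡ b + (b + (6 + k)) + 6
  shift = solve-∀
... | refl = let p , within = hexagons-pattern m (b + 6) Z (shift b (m * 12)) in nest m b p within
  where
  shift : ∀ b k → b + (b + (6 + k)) + 6 ≡ (b + 6) + ((b + 6) + k)
  shift = solve-∀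

-- From a pattern to a labelling

module _ {G : Graph} {W : Fin 3 → ℕ} (W-injective : ∀ {κ κ′} → W κ ≡ W κ′ → κ ≡ κ′)
         (p : Pattern G W) (within : ∀ z → Within 1 (suc (order G + size G)) (lab p z)) where

  private
    bound : ∀ z → pred (lab p z) < order G + size G
    bound z = ≤-trans (≤-reflexive (suc-pred (lab p z) ⦃ >-nonZero (proj₁ (within z)) ⦄)) (≤-pred (proj₂ (within z)))

    number : Element G → Fin (order G + size G)
    number z = fromℕ< (bound z)

    number-label : ∀ z → suc (toℕ (number z)) ≡ lab p z
    number-label z = trans (cong suc (toℕ-fromℕ< (bound z))) (suc-pred (lab p z) ⦃ >-nonZero (proj₁ (within z)) ⦄)

    number-injective : ∀ {x y} → number x ≡ number y → x ≡ y
    number-injective {x} {y} eq = lab-injective p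
      (trans (sym (number-label x)) (trans (cong (suc ∘ toℕ) eq) (number-label y)))

    -- Composing with the bijection `splitAt` turns `number` into an injective self-map of a `Fin`,
    -- hence a surjective one.
    number-surjective : ∀ i → ∃[ z ] number z ≡ i
    number-surjective i =
      let j , eq = injective⇒surjective (number ∘ splitAt (order G)) (splitAt-injective ∘ number-injective) i
      in splitAt (order G) j , eq
      where
      splitAt-injective : ∀ {i j} → splitAt (order G) i ≡ splitAt (order G) j → i ≡ j
      splitAt-injective = left-inverse⇒injective (join (order G) (size G)) (Finₚ.join-splitAt (order G) (size G))

  labeling : Labeling G
  labeling = mk⤖ (number-injective , λ i → let z , eq = number-surjective i in z , λ { refl → eq })

  private
    wv≡ : ∀ u → vertexWeight G labeling u ≡ W (col p (inj₁ u))
    wv≡ u with around p u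
    ... | leaf e i only eq _ = trans (vertexWeight-leaf G labeling i only) (trans (number-label _) (sym eq))
    ... | turn e e′ i i′ only eq _ _ e≢e′ = trans
      (vertexWeight-turn G labeling (e≢e′ ∘ cong (col p ∘ inj₂)) i i′ only)
      (trans (cong₂ _+_ (number-label _) (number-label _)) (sym eq))

    we≡ : ∀ e → edgeWeight G labeling e ≡ W (col p (inj₂ e))
    we≡ e with along p e
    ... | edge eq _ = trans (cong₂ _+_ (number-label _) (number-label _)) (sym eq)

    col-edges≢ : ∀ {u e e′} → e ≢ e′ → Incident G u e → Incident G u e′ → col p (inj₂ e) ≢ col p (inj₂ e′)
    col-edges≢ {u} {e} {e′} e≢e′ i i′ with around p u
    ... | leaf d _ only _ _ = contradiction (trans (only e i) (sym (only e′ i′))) e≢e′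
    ... | turn d d′ _ _ only _ _ _ d≢d′ with only e i | only e′ i′
    ... | inj₁ refl | inj₁ refl = contradiction refl e≢e′
    ... | inj₁ refl | inj₂ refl = d≢d′
    ... | inj₂ refl | inj₁ refl = d≢d′ ∘ sym
    ... | inj₂ refl | inj₂ refl = contradiction refl e≢e′

    col-incident≢ : ∀ {u e} → Incident G u e → col p (inj₁ u) ≢ col p (inj₂ e)
    col-incident≢ {u} {e} i with around p u
    ... | leaf d _ only _ u≢d with only e i
    ... | refl = u≢d
    col-incident≢ {u} {e} i | turn d d′ _ _ only _ u≢d u≢d′ _ with only e i
    ... | inj₁ refl = u≢d
    ... | inj₂ refl = u≢d′

    col-adjacent≢ : ∀ {u v} → Adjacent G u v → col p (inj₁ u) ≢ col p (inj₁ v)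
    col-adjacent≢ (e , l) with along p e | l
    ... | edge _ s≢t | inj₁ (refl , refl) = s≢t
    ... | edge _ s≢t | inj₂ (refl , refl) = s≢t ∘ sym

  labeling-local-total-antimagic : LocalTotalAntimagic G labeling
  labeling-local-total-antimagic = record
    { vertices≢ = λ u v adj eq → col-adjacent≢ adj (W-injective (trans (sym (wv≡ u)) (trans eq (wv≡ v))))
    ; edges≢    = λ { e e′ (e≢e′ , u , i , i′) eq →
        col-edges≢ e≢e′ i i′ (W-injective (trans (sym (we≡ e)) (trans eq (we≡ e′)))) }
    ; incident≢ = λ u e i eq → col-incident≢ i (W-injective (trans (sym (wv≡ u)) (trans eq (we≡ e))))
    }

  labeling-numWeights≤3 : numWeights G labeling ≤ 3
  labeling-numWeights≤3 = Unique-⊆⇒length≤ {ys = map W (allFin 3)} (deduplicate-! (weights G labeling)) value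
    where
    value : ∀ {x} → x ∈ deduplicate _≟_ (weights G labeling) → x ∈ map W (allFin 3)
    value m with ∈-weights⁻ G labeling (∈-deduplicate⁻ _≟_ (weights G labeling) m)
    ... | inj₁ (u , refl) = subst (_∈ map W (allFin 3)) (sym (wv≡ u)) (∈-map⁺ W (∈-allFin _))
    ... | inj₂ (e , refl) = subst (_∈ map W (allFin 3)) (sym (we≡ e)) (∈-map⁺ W (∈-allFin _))

-- The lower bound and the value 3

module _ {G : Graph} (admissible : Admissible G) where

  open Admissible admissible

  -- An edge and its two ends always have three distinct weights.
  3≤numWeights : ∀ f → LocalTotalAntimagic G f → 3 ≤ numWeights G f
  3≤numWeights f lta with fromℕ< {0} {order G} (≤-trans (s≤s z≤n) order≥3)
  ... | u with no-isolated u
  ... | v , e , l = unique-weights⇒length≤numWeights G f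
    ( (vertices≢ u v (e , l) ∷ incident≢ u e (link⇒incidentˡ G l) ∷ [])
    ∷ (incident≢ v e (link⇒incidentʳ G l) ∷ []) ∷ [] ∷ [])
    (All.lookup (vertexWeight∈weights G f u ∷ vertexWeight∈weights G f v ∷ edgeWeight∈weights G f e ∷ []))
    where open LocalTotalAntimagic lta

  pattern⇒χₗₜ≔3 : ∀ {H W} → (∀ {κ κ′} → W κ ≡ W κ′ → κ ≡ κ′) → G ≅ H → (p : Pattern H W) →
                  (∀ z → Within 1 (suc (order H + size H)) (lab p z)) → χₗₜ G ≔ 3
  pattern⇒χₗₜ≔3 {H} W-injective i p within =
    (labeling W-injective q q-within , lta , ≤-antisym (labeling-numWeights≤3 W-injective q q-within) (3≤numWeights _ lta)) ,
    λ { _ (f , f-lta , refl) → 3≤numWeights f f-lta }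
    where
    q = proj₁ (pattern-≅ {G} {H} i p)
    q-within : ∀ z → Within 1 (suc (order G + size G)) (lab q z)
    q-within = proj₂ (pattern-≅ {G} {H} i p) {Within 1 (suc (order G + size G))}
      (subst (λ N → ∀ z → Within 1 (suc N) (lab p z)) (sym (≅⇒total≡ {G} {H} i)) within)
    lta = labeling-local-total-antimagic W-injective q q-within

-- Label ranges for the listed graphs

total-hexagons : ∀ m → order (m · C 6) + size (m · C 6) ≡ m * 12
total-hexagons zero    = refl
total-hexagons (suc m) = trans (regroup (order (m · C 6)) (size (m · C 6))) (cong (12 +_) (total-hexagons m))
  where
  regroup : ∀ o s → (6 + o) + (6 + s) ≡ 12 + (o + s)
  regroup = solve-∀

P₃-within : ∀ z → Within 1 6 (lab P₃-pattern z)
P₃-within (inj₁ u) = from-yes (all? λ u → (1 ≤? lab P₃-pattern (inj₁ u)) ×-dec (lab P₃-pattern (inj₁ u) <? 6)) u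
P₃-within (inj₂ e) = from-yes (all? λ e → (1 ≤? lab P₃-pattern (inj₂ e)) ×-dec (lab P₃-pattern (inj₂ e) <? 6)) e

module _ (m : ℕ) where

  private
    h : ℕ
    h = 6 + m * 12

    6≤h : 6 ≤ h
    6≤h = m≤m+n 6 (m * 12)

    H : Graph
    H = m · C 6 ⊕ P 6

    inner : Σ[ p ∈ Pattern (m · C 6) (weight h) ] (∀ z → Within 6 h (lab p z))
    -- The runs of the path start at 0 and `h`, so the hexagons fill the gap from 6 up to `h`, and
    -- `Z` is again `h`.
    inner = hexagons-pattern m 6 h (+-comm h 6)

    disjoint : ∀ x y → lab (proj₁ inner) x ≢ lab (P₆-pattern h 6≤h) y
    disjoint x y eq = place-skips 0 h (hexagon-slot (P₆⊂C₆ y)) (proj₁ (proj₂ inner x)) (proj₂ (proj₂ inner x)) (sym eq)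

    -- Label 0 sits on the closing edge of the hexagon, which the path lacks.
    path-positive : ∀ y → 1 ≤ lab (P₆-pattern h 6≤h) y
    path-positive y = n≢0⇒n>0 λ eq → misses-closing-edge y
      (hexagon-slot-injective {P₆⊂C₆ y} {inj₂ 0F} (place-injective {0} 6≤h {hexagon-slot (P₆⊂C₆ y)} {inj₁ 0F} eq))
      where
      misses-closing-edge : ∀ y → P₆⊂C₆ y ≢ inj₂ 0F
      misses-closing-edge (inj₁ _) ()
      misses-closing-edge (inj₂ _) ()

    total : 12 + m * 12 ≡ suc (order H + size H)
    total = trans (cong (12 +_) (sym (total-hexagons m))) (regroup (order (m · C 6)) (size (m · C 6)))
      where
      regroup : ∀ o s → 12 + (o + s) ≡ suc ((o + 6) + (s + 5))
      regroup = solve-∀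

  hexagons+P₆-pattern : Σ[ p ∈ Pattern H (weight h) ] (∀ z → Within 1 (suc (order H + size H)) (lab p z))
  hexagons+P₆-pattern = pattern-⊕ (proj₁ inner) (P₆-pattern h 6≤h) disjoint ,
    subst (λ N → ∀ z → Within 1 N (lab (pattern-⊕ (proj₁ inner) (P₆-pattern h 6≤h) disjoint) z)) total
      (pattern-⊕-labels (proj₁ inner) (P₆-pattern h 6≤h) disjoint {Within 1 (12 + m * 12)}
        (λ x → ≤-trans (s≤s z≤n) (proj₁ (proj₂ inner x)) , ≤-trans (proj₂ (proj₂ inner x)) (m≤n+m h 6))
        (λ y → path-positive y , place<b+6+h 0 h (hexagon-slot (P₆⊂C₆ y))))

hexagons-only-pattern : ∀ m → Σ[ p ∈ Pattern (suc m · C 6) (weight (8 + m * 12)) ]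
                        (∀ z → Within 1 (suc (order (suc m · C 6) + size (suc m · C 6))) (lab p z))
hexagons-only-pattern m =
  -- Labels start at `b = 1`, so `Z + 6` has to be `1 + (1 + suc m * 12)`.
  let p , within = hexagons-pattern (suc m) 1 (8 + m * 12) (+-comm (8 + m * 12) 6)
  in p , subst (λ N → ∀ z → Within 1 (suc N) (lab p z)) (sym (total-hexagons (suc m))) within

module _ {G : Graph} (admissible : Admissible G) where

  hexagons+P₆⇒χₗₜ≔3 : ∀ m → G ≅ m · C 6 ⊕ P 6 → χₗₜ G ≔ 3
  hexagons+P₆⇒χₗₜ≔3 m i = let p , within = hexagons+P₆-pattern m in
    pattern⇒χₗₜ≔3 admissible (weight-injective (6 + m * 12)) i p within

  characterised⇒χₗₜ≔3 : (G ≅ P 3) ⊎ (G ≅ P 6) ⊎ (∃[ m ] (m ≥ 1 × G ≅ m · C 6)) ⊎ (∃[ m ] G ≅ m · C 6 ⊕ P 6) → χₗₜ G ≔ 3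
  characterised⇒χₗₜ≔3 (inj₁ i) = pattern⇒χₗₜ≔3 admissible
    (from-yes (all? λ κ → all? λ κ′ → (weight-P₃ κ ≟ weight-P₃ κ′) →-dec (κ Fin.≟ κ′)) _ _) i P₃-pattern P₃-within
  -- The vertices and adjacencies of `∅ ⊕ P 6` compute to those of `P 6`, so `i` serves unchanged.
  characterised⇒χₗₜ≔3 (inj₂ (inj₁ i)) = hexagons+P₆⇒χₗₜ≔3 0 i
  characterised⇒χₗₜ≔3 (inj₂ (inj₂ (inj₁ (suc m , _ , i)))) = let p , within = hexagons-only-pattern m in
    pattern⇒χₗₜ≔3 admissible (weight-injective (8 + m * 12)) i p within
  characterised⇒χₗₜ≔3 (inj₂ (inj₂ (inj₂ (m , i)))) = hexagons+P₆⇒χₗₜ≔3 m i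

theorem3p5 : (G : Graph) → Admissible G →
    (χₗₜ G ≔ 3) ⇔ ((G ≅ P 3) ⊎ (G ≅ P 6) ⊎ (∃[ m ] (m ≥ 1 × G ≅ m · C 6)) ⊎ (∃[ m ] G ≅ m · C 6 ⊕ P 6))
theorem3p5 G admissible = mk⇔
  (λ { ((f , lta , three) , _) → Forward.conclusion G f lta three admissible })
  (characterised⇒χₗₜ≔3 admissible)
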